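{- Let $n,k,t\ge1$ be integers and $\mathcal{A}\subset 2^{[n]}$ a family. Let $\mathcal{F}\subset\mathcal{A}\cap\binom{[n]}{\le k}$ be $t$-intersecting. Let $q,r,r_0\ge1$ satisfy $r>2^{12}\log_2(2k)$, $r\ge 2q$ and $r_0>r$, and assume $\mathcal{A}$ is $r_0$-spread. Then there exist a $t$-intersecting family $\mathcal{S}$ of sets of size at most $q$ and a family $\mathcal{F}'\subset\mathcal{F}$ such that (i) $\mathcal{F}\setminus\mathcal{F}'\subset\mathcal{A}[\mathcal{S}]$; (ii) for every $B\in\mathcal{S}$ there is a family $\mathcal{F}_B\subset\mathcal{F}$ such that $\mathcal{F}_B(B)$ is $r$-spread; (iii) $|\mathcal{F}'|\le (r_0/r)^{ -q-1}|\mathcal{A}|$.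
   Context: $\binom{[n]}{\le k}$ is the family of subsets of $[n]$ of size at most $k$. For $X\subset[n]$ and $\mathcal{G}\subset 2^{[n]}$: $\mathcal{G}(X)=\{G\setminus X: G\in\mathcal{G},\ X\subset G\}$ (a family on $[n]\setminus X$), $\mathcal{G}[X]=\{G\in\mathcal{G}: X\subset G\}$, and for a family $\mathcal{S}$, $\mathcal{G}[\mathcal{S}]=\bigcup_{S\in\mathcal{S}}\mathcal{G}[S]$. For real $r>1$, a family $\mathcal{G}$ is $r$-spread if $|\mathcal{G}(X)|\le r^{ -|X|}|\mathcal{G}|$ for every set $X$. A family is $t$-intersecting if any two (not necessarily distinct) members share at least $t$ elements.
   Formalization: The parameters r and r_0 are rational rather than real, and q is read as a positive integer (for fractional q the bound in (iii) with exponent -q-1 can fail). -}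

module Defs where

open import Data.Bool using (Bool; true; false; _∧_; _∨_; not; T)
open import Data.Nat as ℕ using (ℕ; zero; suc)
open import Data.Integer as ℤ using (+_)
open import Data.Rational as ℚ using (ℚ; _/_; 1ℚ)
open import Data.List using (List; []; _∷_; _++_; map; length; filterᵇ)
open import Data.Vec using (Vec; []; _∷_)
open import Data.Fin.Subset using (Subset; _∩_; _∪_; ∣_∣)
open import Data.Product using (Σ; _×_)

Family : ℕ → Set
Family n = Subset n → Bool

allSubsets : (n : ℕ) → List (Subset n)
allSubsets zero    = [] ∷ []
allSubsets (suc n) = map (true ∷_) (allSubsets n) ++ map (false ∷_) (allSubsets n)

card : ∀ {n} → Family n → ℕ
card {n} G = length (filterᵇ G (allSubsets n))

subsetᵇ : ∀ {n} → Subset n → Subset n → Bool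
subsetᵇ []      []      = true
subsetᵇ (x ∷ X) (y ∷ Y) = (not x ∨ y) ∧ subsetᵇ X Y

disjointᵇ : ∀ {n} → Subset n → Subset n → Bool
disjointᵇ []      []      = true
disjointᵇ (x ∷ X) (y ∷ Y) = not (x ∧ y) ∧ disjointᵇ X Y

-- G(X) = { G \ X : G ∈ G, X ⊆ G }, a family on [n] \ X, represented as the
-- family of subsets Y of [n] with Y ∩ X = ∅ and Y ∪ X ∈ G.
link : ∀ {n} → Family n → Subset n → Family n
link G X Y = disjointᵇ Y X ∧ G (Y ∪ X)

ℕtoℚ : ℕ → ℚ
ℕtoℚ m = (+ m) / 1

infixr 8 _^ℚ_
_^ℚ_ : ℚ → ℕ → ℚ
p ^ℚ zero  = 1ℚ
p ^ℚ suc m = p ℚ.* (p ^ℚ m)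

-- G is r-spread: |G(X)| ≤ r^{-|X|} |G| for every X, i.e. |G(X)| r^{|X|} ≤ |G|
Spread : ∀ {n} → ℚ → Family n → Set
Spread {n} r G = (X : Subset n) → ℕtoℚ (card (link G X)) ℚ.* (r ^ℚ ∣ X ∣) ℚ.≤ ℕtoℚ (card G)

Intersecting : ∀ {n} → ℕ → Family n → Set
Intersecting {n} t G = (X Y : Subset n) → T (G X) → T (G Y) → t ℕ.≤ ∣ X ∩ Y ∣

_⊆F_ : ∀ {n} → Family n → Family n → Set
_⊆F_ {n} F G = (X : Subset n) → T (F X) → T (G X)

-- r > 2^12 · log₂(2k), for r = a/b in lowest terms with r ≥ 1 (so a > 0):
-- equivalent to 2^a > (2k)^(4096·b)
LogBound : ℕ → ℚ → Set
LogBound k r = (2 ℕ.* k) ℕ.^ (4096 ℕ.* ℚ.ℚ.denominatorℕ r) ℕ.< 2 ℕ.^ ℤ.∣ ℚ.ℚ.numerator r ∣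

{-# OPTIONS --safe #-}

-- Greedily extract from F the set X maximising |H(X)| r^|X| over the current family H: maximality
-- makes H(X) r-spread and gives |H| ≤ r^|X| |H(X)|. Stop as soon as |X| > q, when r₀-spreadness of A
-- bounds |H(X)|, hence |H|.
--
-- The extracted sets t-intersect because any two of the spread links contain disjoint members.
-- Indeed, let 2^m > k and let G be a (2048 m)-spread family of sets of size at most k. A uniformly
-- random U ⊆ [n] is the union of m independent sets W of densities 1/(2m), 1/(2m-1), …, 1/(m+1).
-- Exposing one W, replace each S ∈ G by a fragment S′ \ W of least size with S′ ∈ G, S′ ⊆ W ∪ S, and
-- discard the fragments that are not half as small as the previous size bound. Few of them are
-- discarded, as (W, fragment) can be encoded by their union and a subset of one member of G. After
-- m steps the surviving fragments are empty, and U contains a member of G with probability above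
-- 1/2. This applies to one link with U and to the other with the complement of U, once the members
-- meeting the opposite extracted set are removed, which costs at most half of each link as r ≥ 2q.

module Submission where

open import Defs
open import Data.Bool using (Bool; true; false; _∧_; _∨_; not; T; T?; if_then_else_)
open import Data.Bool.ListAction using (any)
import Data.Bool.Properties as Bool
open import Data.Bool.Properties using (T-∨; T-∧)
open import Data.Empty using (⊥-elim)
open import Data.Fin.Subset using (Subset; ∣_∣; _∩_; _∪_; _─_; ∁; ⊥)
open import Data.Fin.Subset.Properties using (∣⊥∣≡0; anySubset?; ∪-assoc)
open import Data.Integer as ℤ using (-[1+_])
import Data.Integer.Properties as ℤ
open import Data.List using (List; []; _∷_; _++_; map; length; filterᵇ; filter)
open import Data.List.Extrema.Nat using (argmin; argmin-sel; f[argmin]≤f[xs])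
open import Data.List.Membership.Propositional using (_∈_; lose; find)
open import Data.List.Membership.Propositional.Properties using (∈-filter⁺; ∈-filter⁻; ∈-map⁻; ∈-map⁺; ∈-++⁺ˡ; ∈-++⁺ʳ)
open import Data.List.Properties using (map-++; map-∘; length-map)
open import Data.List.Relation.Unary.All as All using (All; []; _∷_)
open import Data.List.Relation.Unary.All.Properties using (all-filter; map⁺)
open import Data.List.Relation.Unary.Any using (here; there)
open import Data.List.Relation.Unary.Any.Properties using (any⁺; any⁻)
open import Data.Nat as ℕ using (ℕ; zero; suc; _+_; _*_; _^_; _≤_; z≤n; s≤s; NonZero; _<_; _≤?_; _<?_)
import Data.Nat.Coprimality as Coprimality
open import Data.Nat.ListAction using (sum)
open import Data.Nat.ListAction.Properties using (sum-++)
open import Data.Nat.Properties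
open import Data.Nat.Tactic.RingSolver using (solve-∀)
open import Data.Product using (Σ; _×_; _,_; proj₁; proj₂; ∃)
open import Data.Rational as ℚ using (ℚ; mkℚ; 1ℚ; Positive; NonNegative; *≤*)
import Data.Rational.Properties as ℚ
import Data.Rational.Solver as ℚ
open import Data.Rational.Unnormalised using (*≡*)
import Data.Rational.Unnormalised.Properties as ℚᵘ
open import Data.Sum using (inj₁; inj₂)
open import Data.Vec using ([]; _∷_)
open import Data.Vec.Properties using (≡-dec)
open import Function using (_∘_; Equivalence)
open import Relation.Binary.Bundles using (DecTotalOrder)
open import Relation.Binary.PropositionalEquality using (_≡_; refl; sym; trans; cong; cong₂; subst; module ≡-Reasoning)
open import Relation.Nullary using (Dec; yes; no; ¬_)
open import Relation.Nullary.Decidable using (⌊_⌋; toWitness; fromWitness)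
open import Data.List.Extrema (DecTotalOrder.totalOrder ℚ.≤-decTotalOrder) using (argmax; f[xs]≤f[argmax])

-- Unnormalised product measures on the subsets of [n].

𝟙 : Bool → ℕ
𝟙 true  = 1
𝟙 false = 0

-- The unnormalised product measure on subsets of [n]: an element has weight a
-- inside the set and weight b outside, so the density is a / (a + b).
∫ : ∀ {n} → ℕ → ℕ → (Subset n → ℕ) → ℕ
∫ {zero}  a b f = f []
∫ {suc n} a b f = a * ∫ a b (λ X → f (true ∷ X)) + b * ∫ a b (λ X → f (false ∷ X))

∫-cong : ∀ {n} a b {f g : Subset n → ℕ} → (∀ X → f X ≡ g X) → ∫ a b f ≡ ∫ a b g
∫-cong {zero}  a b h = h []
∫-cong {suc n} a b h =
  cong₂ (λ x y → a * x + b * y) (∫-cong a b (λ X → h (true ∷ X))) (∫-cong a b (λ X → h (false ∷ X)))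

∫-mono : ∀ {n} a b {f g : Subset n → ℕ} → (∀ X → f X ≤ g X) → ∫ a b f ≤ ∫ a b g
∫-mono {zero}  a b h = h []
∫-mono {suc n} a b h =
  +-mono-≤ (*-monoʳ-≤ a (∫-mono a b (λ X → h (true ∷ X)))) (*-monoʳ-≤ b (∫-mono a b (λ X → h (false ∷ X))))

∫-+ : ∀ {n} a b (f g : Subset n → ℕ) → ∫ a b (λ X → f X + g X) ≡ ∫ a b f + ∫ a b g
∫-+ {zero}  a b f g = refl
∫-+ {suc n} a b f g =
  trans (cong₂ (λ x y → a * x + b * y) (∫-+ a b (λ X → f (true ∷ X)) (λ X → g (true ∷ X)))
                                       (∫-+ a b (λ X → f (false ∷ X)) (λ X → g (false ∷ X))))
        (arith a b _ _ _ _)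
  where
  arith : ∀ a b x y z w → a * (x + y) + b * (z + w) ≡ a * x + b * z + (a * y + b * w)
  arith = solve-∀

∫-*ˡ : ∀ {n} a b c (f : Subset n → ℕ) → ∫ a b (λ X → c * f X) ≡ c * ∫ a b f
∫-*ˡ {zero}  a b c f = refl
∫-*ˡ {suc n} a b c f =
  trans (cong₂ (λ x y → a * x + b * y) (∫-*ˡ a b c (λ X → f (true ∷ X))) (∫-*ˡ a b c (λ X → f (false ∷ X))))
        (arith a b c _ _)
  where
  arith : ∀ a b c x y → a * (c * x) + b * (c * y) ≡ c * (a * x + b * y)
  arith = solve-∀

∫-const : ∀ {n} a b c → ∫ {n} a b (λ _ → c) ≡ c * (a + b) ^ n
∫-const {zero}  a b c = sym (*-identityʳ c)
∫-const {suc n} a b c =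
  trans (cong₂ (λ x y → a * x + b * y) (∫-const {n} a b c) (∫-const {n} a b c)) (arith a b c _)
  where
  arith : ∀ a b c p → a * (c * p) + b * (c * p) ≡ c * ((a + b) * p)
  arith = solve-∀

∫-swap : ∀ {n m} a b c d (f : Subset n → Subset m → ℕ) →
  ∫ a b (λ X → ∫ c d (f X)) ≡ ∫ c d (λ Y → ∫ a b (λ X → f X Y))
∫-swap {zero}  a b c d f = refl
∫-swap {suc n} a b c d f = begin
  a * ∫ a b (λ X → ∫ c d (f (true ∷ X))) + b * ∫ a b (λ X → ∫ c d (f (false ∷ X)))
    ≡⟨ cong₂ (λ x y → a * x + b * y) (∫-swap a b c d (λ X → f (true ∷ X))) (∫-swap a b c d (λ X → f (false ∷ X))) ⟩
  a * ∫ c d (λ Y → ∫ a b (λ X → f (true ∷ X) Y)) + b * ∫ c d (λ Y → ∫ a b (λ X → f (false ∷ X) Y))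
    ≡⟨ sym (cong₂ _+_ (∫-*ˡ c d a (λ Y → ∫ a b (λ X → f (true ∷ X) Y)))
                      (∫-*ˡ c d b (λ Y → ∫ a b (λ X → f (false ∷ X) Y)))) ⟩
  ∫ c d (λ Y → a * ∫ a b (λ X → f (true ∷ X) Y)) + ∫ c d (λ Y → b * ∫ a b (λ X → f (false ∷ X) Y))
    ≡⟨ sym (∫-+ c d (λ Y → a * ∫ a b (λ X → f (true ∷ X) Y)) (λ Y → b * ∫ a b (λ X → f (false ∷ X) Y))) ⟩
  ∫ c d (λ Y → a * ∫ a b (λ X → f (true ∷ X) Y) + b * ∫ a b (λ X → f (false ∷ X) Y)) ∎
  where open ≡-Reasoning

-- Densities 1/(1+N) and a/N combine to (a+1)/(1+N): adjoining 1/(2m), 1/(2m-1), …, 1/(m+1)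
-- one after the other produces density exactly 1/2.
∫-∪ : ∀ {n} a b (f : Subset n → ℕ) →
  ∫ 1 (a + b) (λ W → ∫ a b (λ V → f (W ∪ V))) ≡ (a + b) ^ n * ∫ (suc a) b f
∫-∪ {zero}  a b f = sym (+-identityʳ _)
∫-∪ {suc n} a b f = begin
  1 * ∫ 1 N (λ W → a * ∫ a b (λ V → fᵗ (W ∪ V)) + b * ∫ a b (λ V → fᵗ (W ∪ V)))
    + N * ∫ 1 N (λ W → a * ∫ a b (λ V → fᵗ (W ∪ V)) + b * ∫ a b (λ V → fᶠ (W ∪ V)))
    ≡⟨ cong₂ (λ x y → 1 * x + N * y) (split fᵗ fᵗ) (split fᵗ fᶠ) ⟩
  1 * (a * I fᵗ + b * I fᵗ) + N * (a * I fᵗ + b * I fᶠ)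
    ≡⟨ cong₂ (λ x y → 1 * (a * x + b * x) + N * (a * x + b * y)) (∫-∪ a b fᵗ) (∫-∪ a b fᶠ) ⟩
  1 * (a * (P * J fᵗ) + b * (P * J fᵗ)) + N * (a * (P * J fᵗ) + b * (P * J fᶠ))
    ≡⟨ arith a b P (J fᵗ) (J fᶠ) ⟩
  N * P * (suc a * J fᵗ + b * J fᶠ) ∎
  where
  open ≡-Reasoning
  N = a + b
  P = N ^ n
  fᵗ fᶠ : Subset n → ℕ
  fᵗ X = f (true ∷ X)
  fᶠ X = f (false ∷ X)
  I J : (Subset n → ℕ) → ℕ
  I g = ∫ 1 N (λ W → ∫ a b (λ V → g (W ∪ V)))
  J g = ∫ (suc a) b g
  split : ∀ g h → ∫ 1 N (λ W → a * ∫ a b (λ V → g (W ∪ V)) + b * ∫ a b (λ V → h (W ∪ V))) ≡ a * I g + b * I h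
  split g h = trans (∫-+ 1 N (λ W → a * ∫ a b (λ V → g (W ∪ V))) (λ W → b * ∫ a b (λ V → h (W ∪ V)))) (cong₂ _+_ (∫-*ˡ 1 N a (λ W → ∫ a b (λ V → g (W ∪ V))))
                                            (∫-*ˡ 1 N b (λ W → ∫ a b (λ V → h (W ∪ V)))))
  arith : ∀ a b p x y → 1 * (a * (p * x) + b * (p * x)) + (a + b) * (a * (p * x) + b * (p * y))
                      ≡ (a + b) * p * (suc a * x + b * y)
  arith = solve-∀

-- W is determined by W ∪ Φ when disjoint from Φ, and it weighs N ^ ∣ Φ ∣ times as much.
∫-shift : ∀ {n} N (Φ : Subset n) (f : Subset n → ℕ) →
  ∫ 1 N (λ W → 𝟙 (disjointᵇ W Φ) * f (W ∪ Φ)) ≡ N ^ ∣ Φ ∣ * ∫ 1 N (λ Z → 𝟙 (subsetᵇ Φ Z) * f Z)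
∫-shift N []          f = sym (+-identityʳ _)
∫-shift {suc n} N (true ∷ Φ)  f =
  trans (cong₂ (λ x y → 1 * x + N * y) (∫-const {n} 1 N 0) (∫-shift N Φ (λ X → f (true ∷ X))))
        (trans (arith N _ _)
               (cong (λ y → N * N ^ ∣ Φ ∣ * (1 * ∫ 1 N (λ Z → 𝟙 (subsetᵇ Φ Z) * f (true ∷ Z)) + N * y)) (sym (∫-const {n} 1 N 0))))
  where
  arith : ∀ N p x → 1 * 0 + N * (p * x) ≡ N * p * (1 * x + N * 0)
  arith = solve-∀
∫-shift {suc n} N (false ∷ Φ) f =
  trans (cong₂ (λ x y → 1 * x + N * y) (∫-shift N Φ (λ X → f (true ∷ X)))
                                       (∫-shift N Φ (λ X → f (false ∷ X))))
        (arith N (N ^ ∣ Φ ∣) _ _)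
  where
  arith : ∀ N p x y → 1 * (p * x) + N * (p * y) ≡ p * (1 * x + N * y)
  arith = solve-∀

-- With both weights equal to 1 the measure counts subsets, so a single value is one of the
-- summands.
f≤∫ : ∀ {n} (f : Subset n → ℕ) X → f X ≤ ∫ 1 1 f
f≤∫ f []          = ≤-refl
f≤∫ f (true ∷ X)  = ≤-trans (f≤∫ (λ Y → f (true ∷ Y)) X) (≤-trans (≤-reflexive (sym (*-identityˡ _))) (m≤m+n _ _))
f≤∫ f (false ∷ X) = ≤-trans (f≤∫ (λ Y → f (false ∷ Y)) X) (≤-trans (≤-reflexive (sym (*-identityˡ _))) (m≤n+m _ (1 * ∫ 1 1 (λ Y → f (true ∷ Y)))))

∫-powerset : ∀ {n} (C : Subset n) → ∫ 1 1 (λ X → 𝟙 (subsetᵇ X C)) ≡ 2 ^ ∣ C ∣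
∫-powerset []          = refl
∫-powerset (true ∷ C)  =
  trans (cong (λ x → 1 * x + 1 * x) (∫-powerset C)) (arith (2 ^ ∣ C ∣))
  where
  arith : ∀ x → 1 * x + 1 * x ≡ 2 * x
  arith = solve-∀
∫-powerset {suc n} (false ∷ C) =
  trans (cong₂ (λ x y → 1 * x + 1 * y) (∫-const {n} 1 1 0) (∫-powerset C)) (arith (2 ^ ∣ C ∣))
  where
  arith : ∀ x → 1 * 0 + 1 * x ≡ x
  arith = solve-∀

-- Indicators, inclusion and set difference.

𝟙≤1 : ∀ b → 𝟙 b ≤ 1
𝟙≤1 true  = ≤-refl
𝟙≤1 false = z≤n

T⇒𝟙 : ∀ {b} → T b → 𝟙 b ≡ 1
T⇒𝟙 {true} _ = refl

𝟙-mono : ∀ {a b} → (T a → T b) → 𝟙 a ≤ 𝟙 b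
𝟙-mono {false} h = z≤n
𝟙-mono {true}  h = ≤-reflexive (sym (T⇒𝟙 (h _)))

subsetᵇ-refl : ∀ {n} (X : Subset n) → T (subsetᵇ X X)
subsetᵇ-refl []          = _
subsetᵇ-refl (true ∷ X)  = subsetᵇ-refl X
subsetᵇ-refl (false ∷ X) = subsetᵇ-refl X

subsetᵇ-trans : ∀ {n} (X Y Z : Subset n) → T (subsetᵇ X Y) → T (subsetᵇ Y Z) → T (subsetᵇ X Z)
subsetᵇ-trans []          []          []          p q = _
subsetᵇ-trans (false ∷ X) (false ∷ Y) (_ ∷ Z)     p q = subsetᵇ-trans X Y Z p q
subsetᵇ-trans (false ∷ X) (true ∷ Y)  (true ∷ Z)  p q = subsetᵇ-trans X Y Z p q
subsetᵇ-trans (true ∷ X)  (true ∷ Y)  (true ∷ Z)  p q = subsetᵇ-trans X Y Z p q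

∪-monoʳ : ∀ {n} (W X Y : Subset n) → T (subsetᵇ X Y) → T (subsetᵇ (W ∪ X) (W ∪ Y))
∪-monoʳ []          []          []         p = _
∪-monoʳ (true ∷ W)  (false ∷ X) (_ ∷ Y)    p = ∪-monoʳ W X Y p
∪-monoʳ (true ∷ W)  (true ∷ X)  (true ∷ Y) p = ∪-monoʳ W X Y p
∪-monoʳ (false ∷ W) (false ∷ X) (_ ∷ Y)    p = ∪-monoʳ W X Y p
∪-monoʳ (false ∷ W) (true ∷ X)  (true ∷ Y) p = ∪-monoʳ W X Y p

⊆∪⇒─⊆ : ∀ {n} (S W X : Subset n) → T (subsetᵇ S (W ∪ X)) → T (subsetᵇ (S ─ W) X)
⊆∪⇒─⊆ []          []          []          p = _
⊆∪⇒─⊆ (true ∷ S)  (true ∷ W)  (_ ∷ X)     p = ⊆∪⇒─⊆ S W X p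
⊆∪⇒─⊆ (true ∷ S)  (false ∷ W) (true ∷ X)  p = ⊆∪⇒─⊆ S W X p
⊆∪⇒─⊆ (false ∷ S) (true ∷ W)  (_ ∷ X)     p = ⊆∪⇒─⊆ S W X p
⊆∪⇒─⊆ (false ∷ S) (false ∷ W) (_ ∷ X)     p = ⊆∪⇒─⊆ S W X p

─⊆⇒⊆∪ : ∀ {n} (S W X : Subset n) → T (subsetᵇ (S ─ W) X) → T (subsetᵇ S (W ∪ X))
─⊆⇒⊆∪ []          []          []          p = _
─⊆⇒⊆∪ (true ∷ S)  (true ∷ W)  (_ ∷ X)     p = ─⊆⇒⊆∪ S W X p
─⊆⇒⊆∪ (true ∷ S)  (false ∷ W) (true ∷ X)  p = ─⊆⇒⊆∪ S W X p
─⊆⇒⊆∪ (false ∷ S) (true ∷ W)  (_ ∷ X)     p = ─⊆⇒⊆∪ S W X p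
─⊆⇒⊆∪ (false ∷ S) (false ∷ W) (_ ∷ X)     p = ─⊆⇒⊆∪ S W X p

⊆-∪ʳ : ∀ {n} (W X : Subset n) → T (subsetᵇ X (W ∪ X))
⊆-∪ʳ []          []          = _
⊆-∪ʳ (true ∷ W)  (true ∷ X)  = ⊆-∪ʳ W X
⊆-∪ʳ (true ∷ W)  (false ∷ X) = ⊆-∪ʳ W X
⊆-∪ʳ (false ∷ W) (true ∷ X)  = ⊆-∪ʳ W X
⊆-∪ʳ (false ∷ W) (false ∷ X) = ⊆-∪ʳ W X

─-⊆ : ∀ {n} (S W : Subset n) → T (subsetᵇ (S ─ W) S)
─-⊆ S W = ⊆∪⇒─⊆ S W S (⊆-∪ʳ W S)

disjointᵇ-─ : ∀ {n} (S W : Subset n) → T (disjointᵇ W (S ─ W))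
disjointᵇ-─ []          []          = _
disjointᵇ-─ (true ∷ S)  (true ∷ W)  = disjointᵇ-─ S W
disjointᵇ-─ (true ∷ S)  (false ∷ W) = disjointᵇ-─ S W
disjointᵇ-─ (false ∷ S) (true ∷ W)  = disjointᵇ-─ S W
disjointᵇ-─ (false ∷ S) (false ∷ W) = disjointᵇ-─ S W

⊆⇒∣∣≤ : ∀ {n} (X Y : Subset n) → T (subsetᵇ X Y) → ∣ X ∣ ≤ ∣ Y ∣
⊆⇒∣∣≤ []          []          p = z≤n
⊆⇒∣∣≤ (true ∷ X)  (true ∷ Y)  p = s≤s (⊆⇒∣∣≤ X Y p)
⊆⇒∣∣≤ (false ∷ X) (true ∷ Y)  p = m≤n⇒m≤1+n (⊆⇒∣∣≤ X Y p)
⊆⇒∣∣≤ (false ∷ X) (false ∷ Y) p = ⊆⇒∣∣≤ X Y p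

⊆∧∣∣≥⇒≡ : ∀ {n} (X Y : Subset n) → T (subsetᵇ X Y) → ∣ Y ∣ ≤ ∣ X ∣ → X ≡ Y
⊆∧∣∣≥⇒≡ []          []          p q       = refl
⊆∧∣∣≥⇒≡ (true ∷ X)  (true ∷ Y)  p (s≤s q) = cong (true ∷_) (⊆∧∣∣≥⇒≡ X Y p q)
⊆∧∣∣≥⇒≡ (false ∷ X) (true ∷ Y)  p q       = ⊥-elim (<⇒≱ q (⊆⇒∣∣≤ X Y p))
⊆∧∣∣≥⇒≡ (false ∷ X) (false ∷ Y) p q       = cong (false ∷_) (⊆∧∣∣≥⇒≡ X Y p q)

^-distribʳ-* : ∀ d x y → (x * y) ^ d ≡ x ^ d * y ^ d
^-distribʳ-* zero    x y = refl
^-distribʳ-* (suc d) x y = trans (cong (x * y *_) (^-distribʳ-* d x y)) (arith x y (x ^ d) (y ^ d))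
  where
  arith : ∀ x y p q → x * y * (p * q) ≡ x * p * (y * q)
  arith = solve-∀

-- Set systems as lists: sums, degrees and covering.

∑ : {A : Set} → (A → ℕ) → List A → ℕ
∑ f L = sum (map f L)

∑-mono : {A : Set} {f g : A → ℕ} (L : List A) → (∀ {x} → x ∈ L → f x ≤ g x) → ∑ f L ≤ ∑ g L
∑-mono []      h = z≤n
∑-mono (x ∷ L) h = +-mono-≤ (h (here refl)) (∑-mono L (h ∘ there))

∫-∑ : ∀ {n} {A : Set} a b (f : Subset n → A → ℕ) (L : List A) →
  ∫ a b (λ X → ∑ (f X) L) ≡ ∑ (λ x → ∫ a b (λ X → f X x)) L
∫-∑ {n} a b f []      = ∫-const {n} a b 0
∫-∑ a b f (x ∷ L) = trans (∫-+ a b (λ X → f X x) (λ X → ∑ (f X) L)) (cong (_ +_) (∫-∑ a b f L))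

∑-*ʳ : {A : Set} (f : A → ℕ) (c : ℕ) (L : List A) → ∑ (λ x → f x * c) L ≡ ∑ f L * c
∑-*ʳ f c []      = refl
∑-*ʳ f c (x ∷ L) = trans (cong (f x * c +_) (∑-*ʳ f c L)) (sym (*-distribʳ-+ c (f x) (∑ f L)))

-- Lists count repetitions. Distinct sets may leave equal fragments, and keeping both copies
-- preserves the number of sets while degrees do not grow.
degree : ∀ {n} → List (Subset n) → Subset n → ℕ
degree L X = ∑ (λ S → 𝟙 (subsetᵇ X S)) L

covers : ∀ {n} → List (Subset n) → Subset n → Bool
covers L U = any (λ S → subsetᵇ S U) L

∈⇒covers : ∀ {n} {L : List (Subset n)} {S} U → S ∈ L → T (subsetᵇ S U) → T (covers L U)
∈⇒covers U S∈L S⊆U = any⁺ _ (lose S∈L S⊆U)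

covers⇒∈ : ∀ {n} (L : List (Subset n)) U → T (covers L U) → Σ (Subset n) λ S → S ∈ L × T (subsetᵇ S U)
covers⇒∈ L U p = find (any⁻ _ L p)

-- Minimal fragments and their encoding.

module _ {n : ℕ} (L : List (Subset n)) where

  -- The default `S` of `argmin` satisfies `S ⊆ W ∪ S`, so for `S ∈ L` it is already one of the
  -- candidates.
  core : Subset n → Subset n → Subset n
  core W S = argmin (λ S′ → ∣ S′ ─ W ∣) S (filter (λ S′ → T? (subsetᵇ S′ (W ∪ S))) L)

  fragment : Subset n → Subset n → Subset n
  fragment W S = core W S ─ W

  core-⊆ : ∀ W S → T (subsetᵇ (core W S) (W ∪ S))
  core-⊆ W S with argmin-sel (λ S′ → ∣ S′ ─ W ∣) S (filter (λ S′ → T? (subsetᵇ S′ (W ∪ S))) L)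
  ... | inj₁ eq = subst (λ X → T (subsetᵇ X (W ∪ S))) (sym eq) (⊆-∪ʳ W S)
  ... | inj₂ S∈ = proj₂ (∈-filter⁻ (λ S′ → T? (subsetᵇ S′ (W ∪ S))) {xs = L} S∈)

  core-∈ : ∀ W {S} → S ∈ L → core W S ∈ L
  core-∈ W {S} S∈L with argmin-sel (λ S′ → ∣ S′ ─ W ∣) S (filter (λ S′ → T? (subsetᵇ S′ (W ∪ S))) L)
  ... | inj₁ eq = subst (_∈ L) (sym eq) S∈L
  ... | inj₂ S∈ = proj₁ (∈-filter⁻ (λ S′ → T? (subsetᵇ S′ (W ∪ S))) {xs = L} S∈)

  fragment-minimal : ∀ W S {C} → C ∈ L → T (subsetᵇ C (W ∪ S)) → ∣ fragment W S ∣ ≤ ∣ C ─ W ∣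
  fragment-minimal W S C∈L C⊆ =
    All.lookup (f[argmin]≤f[xs] S (filter (λ S′ → T? (subsetᵇ S′ (W ∪ S))) L))
               (∈-filter⁺ (λ S′ → T? (subsetᵇ S′ (W ∪ S))) C∈L C⊆)

  fragment-⊆ : ∀ W S → T (subsetᵇ (fragment W S) S)
  fragment-⊆ W S = ⊆∪⇒─⊆ (core W S) W S (core-⊆ W S)

-- The canonical member depends on `Z` alone, which lets the encoding forget which `S` produced the
-- fragment. The default `⊥` obeys every size bound.
firstIn : ∀ {n} → List (Subset n) → Subset n → Subset n
firstIn []      Z = ⊥
firstIn (S ∷ L) Z = if subsetᵇ S Z then S else firstIn L Z

firstIn-size : ∀ {n} {s} (L : List (Subset n)) Z → All (λ S → ∣ S ∣ ≤ s) L → ∣ firstIn L Z ∣ ≤ s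
firstIn-size {n} []      Z []       = ≤-trans (≤-reflexive (∣⊥∣≡0 n)) z≤n
firstIn-size     (S ∷ L) Z (p ∷ ps) with subsetᵇ S Z
... | true  = p
... | false = firstIn-size L Z ps

firstIn-∈ : ∀ {n} {S} (L : List (Subset n)) Z → S ∈ L → T (subsetᵇ S Z) →
  firstIn L Z ∈ L × T (subsetᵇ (firstIn L Z) Z)
firstIn-∈ (S ∷ L) Z S∈ S⊆Z with subsetᵇ S Z in eq
firstIn-∈ (S ∷ L) Z S∈           S⊆Z | true  = here refl , subst T (sym eq) _
firstIn-∈ (S ∷ L) Z (here refl)  S⊆Z | false = ⊥-elim (subst T eq S⊆Z)
firstIn-∈ (S ∷ L) Z (there S∈)   S⊆Z | false =
  let p , q = firstIn-∈ L Z S∈ S⊆Z in there p , q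

-- Minimality makes the fragment recoverable from Z = W ∪ fragment up to the choice of a
-- subset of a canonical member of L inside Z.
fragment-⊆-firstIn : ∀ {n} (L : List (Subset n)) W {S} → S ∈ L →
  T (subsetᵇ (fragment L W S) (firstIn L (W ∪ fragment L W S)))
fragment-⊆-firstIn L W {S} S∈L = subst (λ X → T (subsetᵇ X C)) C─W≡Φ (─-⊆ C W)
  where
  Φ = fragment L W S
  C = firstIn L (W ∪ Φ)
  found = firstIn-∈ L (W ∪ Φ) (core-∈ L W S∈L) (─⊆⇒⊆∪ (core L W S) W Φ (subsetᵇ-refl Φ))
  C⊆W∪S : T (subsetᵇ C (W ∪ S))
  C⊆W∪S = subsetᵇ-trans C (W ∪ Φ) (W ∪ S) (proj₂ found) (∪-monoʳ W Φ S (fragment-⊆ L W S))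
  -- `C ⊆ W ∪ Φ` gives `C ─ W ⊆ Φ`. As `C` also competes inside `W ∪ S`, minimality of `Φ` turns the
  -- inclusion into an equality.
  C─W≡Φ : C ─ W ≡ Φ
  C─W≡Φ = ⊆∧∣∣≥⇒≡ (C ─ W) Φ (⊆∪⇒─⊆ C W Φ (proj₂ found)) (fragment-minimal L W S (proj₁ found) C⊆W∪S)

-- The spread bound refers to a free `M` instead of `length L`: later lists of fragments are
-- shorter, yet stay measured against the original family.
module _ {n : ℕ} (N h M : ℕ) (L : List (Subset n)) (small : All (λ S → ∣ S ∣ ≤ 2 * h) L)
         (spread : ∀ X → degree L X * (1024 * N) ^ ∣ X ∣ ≤ M) where

  private
    big : Subset n → ℕ
    big Φ = 𝟙 (h ℕ.≤ᵇ ∣ Φ ∣)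

    κ : Subset n → Subset n → ℕ
    κ Z Φ = 𝟙 (subsetᵇ Φ (firstIn L Z))

    K : Subset n → ℕ
    K Φ = ∫ 1 N (λ Z → κ Z Φ)

    -- The factors record what is known of a large fragment `Φ` of `S`: it lies in `S`, misses `W`,
    -- and lies in the canonical member inside `W ∪ Φ`. Summing over all `Φ` bounds the indicator of
    -- a large fragment, because the true fragment contributes 1.
    encoding : Subset n → Subset n → Subset n → ℕ
    encoding S W Φ = big Φ * 𝟙 (subsetᵇ Φ S) * (𝟙 (disjointᵇ W Φ) * κ (W ∪ Φ) Φ)

    encode : ∀ {S} → S ∈ L → ∀ W → big (fragment L W S) ≤ ∫ 1 1 (encoding S W)
    encode {S} S∈L W = ≤-trans (≤-reflexive (sym value)) (f≤∫ (encoding S W) Φ)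
      where
      Φ = fragment L W S
      value : encoding S W Φ ≡ big Φ
      value rewrite T⇒𝟙 (fragment-⊆ L W S) | T⇒𝟙 (disjointᵇ-─ (core L W S) W)
                  | T⇒𝟙 (fragment-⊆-firstIn L W S∈L) = trans (*-identityʳ _) (*-identityʳ _)

    shift : ∀ Φ → ∫ 1 N (λ W → 𝟙 (disjointᵇ W Φ) * κ (W ∪ Φ) Φ) ≤ N ^ ∣ Φ ∣ * K Φ
    shift Φ = ≤-trans (≤-reflexive (∫-shift N Φ (λ Z → κ Z Φ)))
      (*-monoʳ-≤ (N ^ ∣ Φ ∣) (∫-mono 1 N (λ Z →
        ≤-trans (*-monoˡ-≤ (κ Z Φ) (𝟙≤1 (subsetᵇ Φ Z))) (≤-reflexive (*-identityˡ _)))))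

    weight : Subset n → ℕ
    weight Φ = big Φ * (N ^ ∣ Φ ∣ * K Φ)

    -- Exchange the sums over `W` and `Φ`, then replace `W` by `Z = W ∪ Φ`. The change of variable
    -- costs `N ^ ∣ Φ ∣`, and the condition `Φ ⊆ Z` is dropped.
    lost-at : ∀ {S} → S ∈ L → ∫ 1 N (λ W → big (fragment L W S)) ≤ ∫ 1 1 (λ Φ → 𝟙 (subsetᵇ Φ S) * weight Φ)
    lost-at {S} S∈L = begin
      ∫ 1 N (λ W → big (fragment L W S))        ≤⟨ ∫-mono 1 N (encode S∈L) ⟩
      ∫ 1 N (λ W → ∫ 1 1 (encoding S W))        ≡⟨ ∫-swap 1 N 1 1 (encoding S) ⟩
      ∫ 1 1 (λ Φ → ∫ 1 N (λ W → encoding S W Φ))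
        ≤⟨ ∫-mono 1 1 (λ Φ → ≤-trans
             (≤-reflexive (∫-*ˡ 1 N (big Φ * 𝟙 (subsetᵇ Φ S)) (λ W → 𝟙 (disjointᵇ W Φ) * κ (W ∪ Φ) Φ)))
             (≤-trans (*-monoʳ-≤ (big Φ * 𝟙 (subsetᵇ Φ S)) (shift Φ))
                      (≤-reflexive (arith (big Φ) (𝟙 (subsetᵇ Φ S)) (N ^ ∣ Φ ∣ * K Φ))))) ⟩
      ∫ 1 1 (λ Φ → 𝟙 (subsetᵇ Φ S) * weight Φ)  ∎
      where
      open ≤-Reasoning
      arith : ∀ a b c → a * b * c ≡ b * (a * c)
      arith = solve-∀

    -- Spreadness pays `(1024 * N) ^ ∣ Φ ∣`: the powers of `N` absorb the cost of the change of
    -- variable, and the powers of 1024 leave at least `1024 ^ h` since `Φ` is large. The Boolean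
    -- `b` abstracts the size test so that it can be matched on.
    pointwise : ∀ Φ b → (T b → h ≤ ∣ Φ ∣) → 1024 ^ h * (degree L Φ * (𝟙 b * (N ^ ∣ Φ ∣ * K Φ))) ≤ M * K Φ
    pointwise Φ false _ = ≤-trans (≤-reflexive (trans (cong (1024 ^ h *_) (*-zeroʳ (degree L Φ))) (*-zeroʳ (1024 ^ h)))) z≤n
    pointwise Φ true h≤ = begin
      1024 ^ h * (degree L Φ * (1 * (N ^ ∣ Φ ∣ * K Φ)))  ≡⟨ arith (1024 ^ h) (degree L Φ) (N ^ ∣ Φ ∣) (K Φ) ⟩
      degree L Φ * (1024 ^ h * N ^ ∣ Φ ∣) * K Φ
        ≤⟨ *-monoˡ-≤ (K Φ) (*-monoʳ-≤ (degree L Φ) (*-monoˡ-≤ (N ^ ∣ Φ ∣) (^-monoʳ-≤ 1024 (h≤ _)))) ⟩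
      degree L Φ * (1024 ^ ∣ Φ ∣ * N ^ ∣ Φ ∣) * K Φ      ≡⟨ cong (λ x → degree L Φ * x * K Φ) (sym (^-distribʳ-* ∣ Φ ∣ 1024 N)) ⟩
      degree L Φ * (1024 * N) ^ ∣ Φ ∣ * K Φ              ≤⟨ *-monoˡ-≤ (K Φ) (spread Φ) ⟩
      M * K Φ ∎
      where
      open ≤-Reasoning
      arith : ∀ t d p k → t * (d * (1 * (p * k))) ≡ d * (t * p) * k
      arith = solve-∀

    -- For each `Z`, the set `Φ` is one of at most `2 ^ (2 * h)` subsets of the canonical member.
    ∫K : ∫ 1 1 K ≤ 4 ^ h * (1 + N) ^ n
    ∫K = begin
      ∫ 1 1 (λ Φ → ∫ 1 N (λ Z → κ Z Φ))  ≡⟨ ∫-swap 1 1 1 N (λ Φ Z → κ Z Φ) ⟩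
      ∫ 1 N (λ Z → ∫ 1 1 (κ Z))
        ≤⟨ ∫-mono 1 N (λ Z → begin
             ∫ 1 1 (κ Z)          ≡⟨ ∫-powerset (firstIn L Z) ⟩
             2 ^ ∣ firstIn L Z ∣  ≤⟨ ^-monoʳ-≤ 2 (firstIn-size L Z small) ⟩
             2 ^ (2 * h)          ≡⟨ sym (^-*-assoc 2 2 h) ⟩
             4 ^ h ∎) ⟩
      ∫ {n} 1 N (λ _ → 4 ^ h)            ≡⟨ ∫-const {n} 1 N (4 ^ h) ⟩
      4 ^ h * (1 + N) ^ n ∎
      where open ≤-Reasoning

  -- After division by the total mass `(1 + N) ^ n`, the expected number of members whose fragment
  -- has at least `h` elements is at most `M / 256 ^ h`: a gain of `1024 ^ h` from spreadness
  -- against `4 ^ h` choices of a subset.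
  few-big-fragments :
    1024 ^ h * ∑ (λ S → ∫ 1 N (λ W → 𝟙 (h ℕ.≤ᵇ ∣ fragment L W S ∣))) L ≤ M * (4 ^ h * (1 + N) ^ n)
  few-big-fragments = begin
    1024 ^ h * ∑ (λ S → ∫ 1 N (λ W → big (fragment L W S))) L
      ≤⟨ *-monoʳ-≤ (1024 ^ h) (∑-mono L lost-at) ⟩
    1024 ^ h * ∑ (λ S → ∫ 1 1 (λ Φ → 𝟙 (subsetᵇ Φ S) * weight Φ)) L
      ≡⟨ cong (1024 ^ h *_) (sym (∫-∑ 1 1 (λ Φ S → 𝟙 (subsetᵇ Φ S) * weight Φ) L)) ⟩
    1024 ^ h * ∫ 1 1 (λ Φ → ∑ (λ S → 𝟙 (subsetᵇ Φ S) * weight Φ) L)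
      ≡⟨ cong (1024 ^ h *_) (∫-cong 1 1 (λ Φ → ∑-*ʳ (λ S → 𝟙 (subsetᵇ Φ S)) (weight Φ) L)) ⟩
    1024 ^ h * ∫ 1 1 (λ Φ → degree L Φ * weight Φ)
      ≡⟨ sym (∫-*ˡ 1 1 (1024 ^ h) (λ Φ → degree L Φ * weight Φ)) ⟩
    ∫ 1 1 (λ Φ → 1024 ^ h * (degree L Φ * weight Φ))  ≤⟨ ∫-mono 1 1 (λ Φ → pointwise Φ (h ℕ.≤ᵇ ∣ Φ ∣) (≤ᵇ⇒≤ h ∣ Φ ∣)) ⟩
    ∫ 1 1 (λ Φ → M * K Φ)                             ≡⟨ ∫-*ˡ 1 1 M K ⟩
    M * ∫ 1 1 K                                       ≤⟨ *-monoʳ-≤ M ∫K ⟩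
    M * (4 ^ h * (1 + N) ^ n) ∎
    where open ≤-Reasoning

-- Random sets covering a member of a spread system.

∫-affine : ∀ {n} a b c d (f : Subset n → ℕ) → ∫ a b (λ X → c * f X + d) ≡ c * ∫ a b f + d * (a + b) ^ n
∫-affine {n} a b c d f =
  trans (∫-+ a b (λ X → c * f X) (λ _ → d)) (cong₂ _+_ (∫-*ˡ a b c f) (∫-const {n} a b d))

∫-scale : ∀ {n} c (f : Subset n → ℕ) → ∫ c c f ≡ c ^ n * ∫ 1 1 f
∫-scale {zero}  c f = sym (+-identityʳ _)
∫-scale {suc n} c f =
  trans (cong₂ (λ x y → c * x + c * y) (∫-scale c (λ X → f (true ∷ X))) (∫-scale c (λ X → f (false ∷ X))))
        (arith c (c ^ n) _ (∫ 1 1 (λ X → f (false ∷ X))))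
  where
  arith : ∀ c p x y → c * (p * x) + c * (p * y) ≡ c * p * (1 * x + 1 * y)
  arith = solve-∀

∫-∁ : ∀ {n} (f : Subset n → ℕ) → ∫ 1 1 (λ X → f (∁ X)) ≡ ∫ 1 1 f
∫-∁ {zero}  f = refl
∫-∁ {suc n} f =
  trans (cong₂ (λ x y → 1 * x + 1 * y) (∫-∁ (λ X → f (false ∷ X))) (∫-∁ (λ X → f (true ∷ X))))
        (+-comm (1 * ∫ 1 1 (λ X → f (false ∷ X))) _)

∣S∣≡0⇒⊆ : ∀ {n} (S U : Subset n) → ∣ S ∣ < 1 → T (subsetᵇ S U)
∣S∣≡0⇒⊆ []          []      p       = _
∣S∣≡0⇒⊆ (true ∷ S)  (_ ∷ U) (s≤s ())
∣S∣≡0⇒⊆ (false ∷ S) (_ ∷ U) p       = ∣S∣≡0⇒⊆ S U p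

⊥⊆ : ∀ {n} (S : Subset n) → T (subsetᵇ ⊥ S)
⊥⊆ {n} S = ∣S∣≡0⇒⊆ ⊥ S (s≤s (≤-reflexive (∣⊥∣≡0 n)))

degree-⊥ : ∀ {n} (L : List (Subset n)) → degree L ⊥ ≡ length L
degree-⊥ []      = refl
degree-⊥ (S ∷ L) = cong₂ _+_ (T⇒𝟙 (⊥⊆ S)) (degree-⊥ L)

length≤ : ∀ {n} (L : List (Subset n)) {R M} → (∀ X → degree L X * R ^ ∣ X ∣ ≤ M) → length L ≤ M
length≤ {n} L {R} {M} spread = begin
  length L                  ≡⟨ sym (degree-⊥ L) ⟩
  degree L ⊥                ≡⟨ sym (*-identityʳ _) ⟩
  degree L ⊥ * R ^ 0        ≡⟨ cong (λ x → degree L ⊥ * R ^ x) (sym (∣⊥∣≡0 n)) ⟩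
  degree L ⊥ * R ^ ∣ ⊥ {n} ∣ ≤⟨ spread ⊥ ⟩
  M ∎
  where open ≤-Reasoning

survivors : ∀ {n} → ℕ → (Subset n → Subset n) → List (Subset n) → List (Subset n)
survivors h φ L = filter (λ Φ → ∣ Φ ∣ <? h) (map φ L)

length≤survivors+lost : ∀ {n} h φ (L : List (Subset n)) →
  length L ≤ length (survivors h φ L) + ∑ (λ S → 𝟙 (h ℕ.≤ᵇ ∣ φ S ∣)) L
length≤survivors+lost h φ []      = z≤n
length≤survivors+lost h φ (S ∷ L) with ∣ φ S ∣ ℕ.<ᵇ h in e₁ | h ℕ.≤ᵇ ∣ φ S ∣ in e₂
... | true  | b     = s≤s (≤-trans (length≤survivors+lost h φ L) (+-monoʳ-≤ (length (survivors h φ L)) (m≤n+m _ (𝟙 b))))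
... | false | true  = ≤-trans (s≤s (length≤survivors+lost h φ L)) (≤-reflexive (sym (+-suc _ _)))
... | false | false with ∣ φ S ∣ <? h
...   | yes p = ⊥-elim (subst T e₁ (<⇒<ᵇ p))
...   | no ¬p = ⊥-elim (subst T e₂ (≤⇒≤ᵇ (≮⇒≥ ¬p)))

degree-survivors : ∀ {n} h φ (L : List (Subset n)) X → (∀ S → T (subsetᵇ (φ S) S)) →
  degree (survivors h φ L) X ≤ degree L X
degree-survivors h φ []      X φ⊆ = z≤n
degree-survivors h φ (S ∷ L) X φ⊆ with ∣ φ S ∣ ℕ.<ᵇ h
... | true  = +-mono-≤ (𝟙-mono (λ p → subsetᵇ-trans X (φ S) S p (φ⊆ S))) (degree-survivors h φ L X φ⊆)
... | false = ≤-trans (degree-survivors h φ L X φ⊆) (m≤n+m _ (𝟙 (subsetᵇ X S)))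

-- A fragment is a member of `L` with `W` removed, so once the fragment lies in `V` that whole
-- member lies in `W ∪ V`.
covers-survivors : ∀ {n} h (L : List (Subset n)) W V →
  T (covers (survivors h (fragment L W) L) V) → T (covers L (W ∪ V))
covers-survivors h L W V p with covers⇒∈ (survivors h (fragment L W) L) V p
... | Φ , Φ∈ , Φ⊆V with ∈-map⁻ (fragment L W) (proj₁ (∈-filter⁻ (λ Φ → ∣ Φ ∣ <? h) {xs = map (fragment L W) L} Φ∈))
...   | S , S∈L , refl = ∈⇒covers (W ∪ V) (core-∈ L W S∈L) (─⊆⇒⊆∪ (core L W S) W V Φ⊆V)

n<2^n : ∀ n → n < 2 ^ n
n<2^n zero    = s≤s z≤n
n<2^n (suc n) = begin-strict
  suc n          ≤⟨ n<2^n n ⟩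
  2 ^ n          <⟨ m<m*n (2 ^ n) 2 {{m^n≢0 2 n}} (s≤s (s≤s z≤n)) ⟩
  2 ^ n * 2      ≡⟨ *-comm (2 ^ n) 2 ⟩
  2 * 2 ^ n ∎
  where open ≤-Reasoning

-- Cancelling `4 ^ h` leaves `256 ^ h = 2 ^ (8 * h)`, far above `2 ^ (2 + i)`. The weaker form is
-- chosen because the losses `2 ^ -(2 + i)` over all rounds add up to less than 1/2.
few-lost : ∀ i M P Λ → 1024 ^ (2 ^ i) * Λ ≤ M * (4 ^ (2 ^ i) * P) → 2 ^ (2 + i) * Λ ≤ M * P
few-lost i M P Λ bound = begin
  2 ^ (2 + i) * Λ  ≤⟨ *-monoˡ-≤ Λ (^-monoʳ-≤ 2 exponent) ⟩
  2 ^ (8 * h) * Λ  ≡⟨ cong (_* Λ) (sym (^-*-assoc 2 8 h)) ⟩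
  256 ^ h * Λ      ≤⟨ *-cancelˡ-≤ (4 ^ h) {{m^n≢0 4 h}} (begin
    4 ^ h * (256 ^ h * Λ)  ≡⟨ sym (*-assoc (4 ^ h) (256 ^ h) Λ) ⟩
    4 ^ h * 256 ^ h * Λ    ≡⟨ cong (_* Λ) (sym (^-distribʳ-* h 4 256)) ⟩
    1024 ^ h * Λ           ≤⟨ bound ⟩
    M * (4 ^ h * P)        ≡⟨ arith M (4 ^ h) P ⟩
    4 ^ h * (M * P) ∎) ⟩
  M * P ∎
  where
  open ≤-Reasoning
  h = 2 ^ i
  arith : ∀ m f p → m * (f * p) ≡ f * (m * p)
  arith = solve-∀
  exponent : 2 + i ≤ 8 * h
  exponent = ≤-trans (s≤s (n<2^n i)) (≤-trans (m<m*n h 8 {{m^n≢0 2 i}} (s≤s (s≤s z≤n))) (≤-reflexive (*-comm h 8)))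

-- With M = length L this says that a random set of density i / (i + b) contains no member
-- of L with probability at most 1/2 - 2 ^ -(i+1).
module _ {n : ℕ} (b R M : ℕ) .{{_ : NonZero b}} where

  coverage : ∀ i (L : List (Subset n)) → 1024 * (i + b) ≤ R → All (λ S → ∣ S ∣ < 2 ^ i) L →
    (∀ X → degree L X * R ^ ∣ X ∣ ≤ M) →
    2 ^ (1 + i) * (length L * (i + b) ^ n) + M * (i + b) ^ n
      ≤ 2 ^ (1 + i) * (M * ∫ i b (λ U → 𝟙 (covers L U))) + 2 ^ i * (M * (i + b) ^ n)
  coverage zero [] R≥ small spread = ≤-trans (≤-reflexive (sym (*-identityˡ _))) (m≤n+m _ (2 * (M * ∫ {n} 0 b (λ _ → 0))))
  -- Sets of size below `2 ^ 0` are empty, so every `U` covers. What remains is `length L ≤ M`, the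
  -- spread bound at `⊥`.
  coverage zero L@(S ∷ L′) R≥ (∣S∣<1 ∷ _) spread =
    +-mono-≤ (*-monoʳ-≤ 2 (≤-trans (*-monoˡ-≤ (b ^ n) (length≤ L spread)) (≤-reflexive (cong (M *_) (sym full)))))
             (≤-reflexive (sym (*-identityˡ _)))
    where
    full : ∫ 0 b (λ U → 𝟙 (covers L U)) ≡ b ^ n
    full = trans (∫-cong 0 b (λ U → T⇒𝟙 (∈⇒covers {L = L} U (here refl) (∣S∣≡0⇒⊆ S U ∣S∣<1))))
                 (trans (∫-const {n} 0 b 1) (*-identityˡ _))
  coverage (suc i) L R≥ small spread = begin
    -- The lost members cost one further `M * P′`; the total is then twice the left side of the
    -- averaged inequality for `i`.
    2 ^ (2 + i) * (l * P′) + M * P′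
      ≤⟨ +-monoˡ-≤ (M * P′) (*-monoʳ-≤ (2 ^ (2 + i)) remaining) ⟩
    2 ^ (2 + i) * (A + Λ) + M * P′
      ≡⟨ cong (_+ M * P′) (*-distribˡ-+ (2 ^ (2 + i)) A Λ) ⟩
    2 ^ (2 + i) * A + 2 ^ (2 + i) * Λ + M * P′
      ≤⟨ +-monoˡ-≤ (M * P′) (+-monoʳ-≤ (2 ^ (2 + i) * A) lost) ⟩
    2 ^ (2 + i) * A + M * P′ + M * P′
      ≡⟨ arith₁ (2 ^ i) A (M * P′) ⟩
    2 * (2 ^ (1 + i) * A + M * P′)
      ≤⟨ *-monoʳ-≤ 2 averaged ⟩
    2 * (2 ^ (1 + i) * (M * E′) + 2 ^ i * (M * P′))
      ≡⟨ arith₂ (2 ^ i) (M * E′) (M * P′) ⟩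
    2 ^ (2 + i) * (M * E′) + 2 ^ (1 + i) * (M * P′) ∎
    where
    open ≤-Reasoning
    N h l P P′ A E′ Λ : ℕ
    N  = i + b
    h  = 2 ^ i
    l  = length L
    P  = N ^ n
    P′ = (suc N) ^ n
    L′ : Subset n → List (Subset n)
    L′ W = survivors h (fragment L W) L
    f : Subset n → ℕ
    f U = 𝟙 (covers L U)
    A  = ∫ 1 N (λ W → length (L′ W))
    E′ = ∫ (suc i) b f
    Λ  = ∑ (λ S → ∫ 1 N (λ W → 𝟙 (h ℕ.≤ᵇ ∣ fragment L W S ∣))) L

    arith₁ : ∀ t a m → 2 * (2 * t) * a + m + m ≡ 2 * (2 * t * a + m)
    arith₁ = solve-∀
    arith₂ : ∀ t a m → 2 * (2 * t * a + t * m) ≡ 2 * (2 * t) * a + 2 * t * m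
    arith₂ = solve-∀

    R≥′ : 1024 * N ≤ R
    R≥′ = ≤-trans (*-monoʳ-≤ 1024 (n≤1+n N)) R≥

    remaining : l * P′ ≤ A + Λ
    remaining = begin
      l * P′                                 ≡⟨ sym (∫-const {n} 1 N l) ⟩
      ∫ {n} 1 N (λ _ → l)                    ≤⟨ ∫-mono 1 N (λ W → length≤survivors+lost h (fragment L W) L) ⟩
      ∫ 1 N (λ W → length (L′ W) + lostAt W)  ≡⟨ ∫-+ 1 N (λ W → length (L′ W)) lostAt ⟩
      A + ∫ 1 N lostAt                        ≡⟨ cong (A +_) (∫-∑ 1 N (λ W S → 𝟙 (h ℕ.≤ᵇ ∣ fragment L W S ∣)) L) ⟩
      A + Λ ∎
      where
      lostAt : Subset n → ℕ
      lostAt W = ∑ (λ S → 𝟙 (h ℕ.≤ᵇ ∣ fragment L W S ∣)) L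

    lost : 2 ^ (2 + i) * Λ ≤ M * P′
    lost = few-lost i M P′ Λ (few-big-fragments N h M L (All.map <⇒≤ small)
      (λ X → ≤-trans (*-monoʳ-≤ (degree L X) (^-monoˡ-≤ ∣ X ∣ R≥′)) (spread X)))

    hypothesis : ∀ W → 2 ^ (1 + i) * P * length (L′ W) + M * P
      ≤ 2 ^ (1 + i) * M * ∫ i b (λ V → f (W ∪ V)) + 2 ^ i * (M * P)
    hypothesis W = begin
      2 ^ (1 + i) * P * length (L′ W) + M * P
        ≡⟨ cong (_+ M * P) (arith (2 ^ (1 + i)) P (length (L′ W))) ⟩
      2 ^ (1 + i) * (length (L′ W) * P) + M * P
        -- For each fixed `W` the induction hypothesis applies to the survivors with the same `R`
        -- and `M`, as their degrees do not exceed those of `L`.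
        ≤⟨ coverage i (L′ W) R≥′ (all-filter (λ Φ → ∣ Φ ∣ <? h) (map (fragment L W) L))
             (λ X → ≤-trans (*-monoˡ-≤ (R ^ ∣ X ∣) (degree-survivors h (fragment L W) L X (fragment-⊆ L W))) (spread X)) ⟩
      2 ^ (1 + i) * (M * ∫ i b (λ V → 𝟙 (covers (L′ W) V))) + 2 ^ i * (M * P)
        ≤⟨ +-monoˡ-≤ (2 ^ i * (M * P)) (*-monoʳ-≤ (2 ^ (1 + i)) (*-monoʳ-≤ M
             (∫-mono i b (λ V → 𝟙-mono (covers-survivors h L W V))))) ⟩
      2 ^ (1 + i) * (M * ∫ i b (λ V → f (W ∪ V))) + 2 ^ i * (M * P)
        ≡⟨ cong (_+ 2 ^ i * (M * P)) (sym (*-assoc (2 ^ (1 + i)) M _)) ⟩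
      2 ^ (1 + i) * M * ∫ i b (λ V → f (W ∪ V)) + 2 ^ i * (M * P) ∎
      where
      arith : ∀ t p a → t * p * a ≡ t * (a * p)
      arith = solve-∀

    averaged : 2 ^ (1 + i) * A + M * P′ ≤ 2 ^ (1 + i) * (M * E′) + 2 ^ i * (M * P′)
    -- `P` is the total mass of the second random set `V`; `∫-∪` produces the same factor when
    -- `W ∪ V` is merged into one set of weights `suc i` and `b`.
    averaged = *-cancelˡ-≤ P {{m^n≢0 N n {{N≢0}}}} (begin
      P * (2 ^ (1 + i) * A + M * P′)
        ≡⟨ arith₃ P (2 ^ (1 + i)) A M P′ ⟩
      2 ^ (1 + i) * P * A + M * P * P′
        ≡⟨ sym (∫-affine 1 N (2 ^ (1 + i) * P) (M * P) (λ W → length (L′ W))) ⟩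
      ∫ 1 N (λ W → 2 ^ (1 + i) * P * length (L′ W) + M * P)
        ≤⟨ ∫-mono 1 N hypothesis ⟩
      ∫ 1 N (λ W → 2 ^ (1 + i) * M * ∫ i b (λ V → f (W ∪ V)) + 2 ^ i * (M * P))
        ≡⟨ ∫-affine 1 N (2 ^ (1 + i) * M) (2 ^ i * (M * P)) (λ W → ∫ i b (λ V → f (W ∪ V))) ⟩
      2 ^ (1 + i) * M * ∫ 1 N (λ W → ∫ i b (λ V → f (W ∪ V))) + 2 ^ i * (M * P) * P′
        ≡⟨ cong (λ x → 2 ^ (1 + i) * M * x + 2 ^ i * (M * P) * P′) (∫-∪ i b f) ⟩
      2 ^ (1 + i) * M * (P * E′) + 2 ^ i * (M * P) * P′
        ≡⟨ arith₄ (2 ^ (1 + i)) (2 ^ i) M P E′ P′ ⟩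
      P * (2 ^ (1 + i) * (M * E′) + 2 ^ i * (M * P′)) ∎)
      where
      N≢0 : NonZero N
      N≢0 = ℕ.>-nonZero (≤-trans (ℕ.>-nonZero⁻¹ b) (m≤n+m b i))
      arith₃ : ∀ p t a m q → p * (t * a + m * q) ≡ t * p * a + m * p * q
      arith₃ = solve-∀
      arith₄ : ∀ t s m p e q → t * m * (p * e) + s * (m * p) * q ≡ p * (t * (m * e) + s * (m * q))
      arith₄ = solve-∀

-- Take `i = b = m` and `M = length L` in `coverage`: the density is `m / (m + m)`, and
-- `1024 * (m + m)` is `2048 * m`. Strictness comes from the surplus `2 ^ -(m + 1)` in that bound.
random-half-covers : ∀ {n} m .{{_ : NonZero m}} (L : List (Subset n)) → 0 < length L →
  All (λ S → ∣ S ∣ < 2 ^ m) L → (∀ X → degree L X * (2048 * m) ^ ∣ X ∣ ≤ length L) →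
  2 ^ n < 2 * ∫ 1 1 (λ U → 𝟙 (covers L U))
random-half-covers {n} m L L>0 small spread = ≰⇒> λ 2H≤D → <⇒≱ (m^n>0 2 n) (+-cancelˡ-≤ (2 * t * D) D 0 (begin
  2 * t * D + D          ≤⟨ *-cancelˡ-≤ Q {{Q≢0}} cancelled ⟩
  2 * t * H + t * D      ≡⟨ arith₁ t H D ⟩
  t * (2 * H) + t * D    ≤⟨ +-monoˡ-≤ (t * D) (*-monoʳ-≤ t 2H≤D) ⟩
  t * D + t * D          ≡⟨ arith₂ t D ⟩
  2 * t * D + 0 ∎))
  where
  open ≤-Reasoning
  M D H t Q : ℕ
  M = length L
  D = 2 ^ n
  H = ∫ 1 1 (λ U → 𝟙 (covers L U))
  t = 2 ^ m
  Q = M * m ^ n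
  Q≢0 : NonZero Q
  Q≢0 = m*n≢0 M (m ^ n) {{ℕ.>-nonZero L>0}} {{m^n≢0 m n}}
  arith₁ : ∀ t h d → 2 * t * h + t * d ≡ t * (2 * h) + t * d
  arith₁ = solve-∀
  arith₂ : ∀ t d → t * d + t * d ≡ 2 * t * d + 0
  arith₂ = solve-∀
  double : ∀ m → m + m ≡ m * 2
  double = solve-∀
  power-split : (m + m) ^ n ≡ m ^ n * D
  power-split = trans (cong (_^ n) (double m)) (^-distribʳ-* n m 2)
  arith₃ : ∀ l p t d → l * p * (2 * t * d + d) ≡ 2 * t * (l * (p * d)) + l * (p * d)
  arith₃ = solve-∀
  arith₄ : ∀ l p t h d → 2 * t * (l * (p * h)) + t * (l * (p * d)) ≡ l * p * (2 * t * h + t * d)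
  arith₄ = solve-∀
  1024[m+m] : ∀ m → 1024 * (m + m) ≡ 2048 * m
  1024[m+m] = solve-∀
  cancelled : Q * (2 * t * D + D) ≤ Q * (2 * t * H + t * D)
  cancelled = begin
    Q * (2 * t * D + D)                                ≡⟨ arith₃ M (m ^ n) t D ⟩
    2 * t * (M * (m ^ n * D)) + M * (m ^ n * D)        ≡⟨ cong (λ x → 2 * t * (M * x) + M * x) (sym power-split) ⟩
    2 * t * (M * (m + m) ^ n) + M * (m + m) ^ n
      ≤⟨ coverage m (2048 * m) M m L (≤-reflexive (1024[m+m] m)) small spread ⟩
    2 * t * (M * ∫ m m (λ U → 𝟙 (covers L U))) + t * (M * (m + m) ^ n)
      ≡⟨ cong₂ (λ x y → 2 * t * (M * x) + t * (M * y)) (∫-scale m (λ U → 𝟙 (covers L U))) power-split ⟩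
    2 * t * (M * (m ^ n * H)) + t * (M * (m ^ n * D))  ≡⟨ arith₄ M (m ^ n) t H D ⟩
    Q * (2 * t * H + t * D) ∎

-- Disjoint members of two covering systems.

⊆∧⊆∁⇒disjointᵇ : ∀ {n} (X Y U : Subset n) → T (subsetᵇ X U) → T (subsetᵇ Y (∁ U)) → T (disjointᵇ X Y)
⊆∧⊆∁⇒disjointᵇ []          []          []          p q = _
⊆∧⊆∁⇒disjointᵇ (false ∷ X) (true ∷ Y)  (false ∷ U) p q = ⊆∧⊆∁⇒disjointᵇ X Y U p q
⊆∧⊆∁⇒disjointᵇ (false ∷ X) (false ∷ Y) (_ ∷ U)     p q = ⊆∧⊆∁⇒disjointᵇ X Y U p q
⊆∧⊆∁⇒disjointᵇ (true ∷ X)  (false ∷ Y) (true ∷ U)  p q = ⊆∧⊆∁⇒disjointᵇ X Y U p q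

-- Both a uniformly random set and its complement cover with probability above 1/2.
disjoint-members : ∀ {n} (L₁ L₂ : List (Subset n)) →
  2 ^ n < 2 * ∫ 1 1 (λ U → 𝟙 (covers L₁ U)) → 2 ^ n < 2 * ∫ 1 1 (λ U → 𝟙 (covers L₂ U)) →
  ∃ λ X → ∃ λ Y → X ∈ L₁ × Y ∈ L₂ × T (disjointᵇ X Y)
disjoint-members {n} L₁ L₂ half₁ half₂ with anySubset? (λ U → T? (covers L₁ U ∧ covers L₂ (∁ U)))
... | yes (U , p) =
  let p₁ , p₂ = Equivalence.to T-∧ p
      X , X∈ , X⊆ = covers⇒∈ L₁ U p₁
      Y , Y∈ , Y⊆ = covers⇒∈ L₂ (∁ U) p₂
  in X , Y , X∈ , Y∈ , ⊆∧⊆∁⇒disjointᵇ X Y U X⊆ Y⊆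
... | no ¬p = ⊥-elim (<⇒≱ (+-mono-< half₁ half₂) (begin
  2 * ∫ 1 1 f₁ + 2 * ∫ 1 1 f₂               ≡⟨ sym (*-distribˡ-+ 2 (∫ 1 1 f₁) (∫ 1 1 f₂)) ⟩
  2 * (∫ 1 1 f₁ + ∫ 1 1 f₂)                 ≡⟨ cong (λ x → 2 * (∫ 1 1 f₁ + x)) (sym (∫-∁ f₂)) ⟩
  2 * (∫ 1 1 f₁ + ∫ 1 1 (λ U → f₂ (∁ U)))   ≡⟨ cong (2 *_) (sym (∫-+ 1 1 f₁ (λ U → f₂ (∁ U)))) ⟩
  2 * ∫ 1 1 (λ U → f₁ U + f₂ (∁ U))         ≤⟨ *-monoʳ-≤ 2 (∫-mono 1 1 (λ U → exclusive (covers L₁ U) (covers L₂ (∁ U)) (λ p → ¬p (U , p)))) ⟩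
  2 * ∫ {n} 1 1 (λ _ → 1)                   ≡⟨ cong (2 *_) (∫-const {n} 1 1 1) ⟩
  2 * (1 * 2 ^ n)                           ≡⟨ arith (2 ^ n) ⟩
  2 ^ n + 2 ^ n ∎))
  where
  open ≤-Reasoning
  f₁ f₂ : Subset n → ℕ
  f₁ U = 𝟙 (covers L₁ U)
  f₂ U = 𝟙 (covers L₂ U)
  arith : ∀ d → 2 * (1 * d) ≡ d + d
  arith = solve-∀
  exclusive : ∀ a b → ¬ T (a ∧ b) → 𝟙 a + 𝟙 b ≤ 1
  exclusive true  true  h = ⊥-elim (h _)
  exclusive true  false h = ≤-refl
  exclusive false true  h = ≤-refl
  exclusive false false h = z≤n

-- Cardinalities of families and links as counting integrals.

𝟙-∧ : ∀ a b → 𝟙 (a ∧ b) ≡ 𝟙 a * 𝟙 b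
𝟙-∧ true  b = sym (+-identityʳ (𝟙 b))
𝟙-∧ false b = refl

∑-filterᵇ : {A : Set} (f : A → ℕ) (p : A → Bool) (L : List A) → ∑ f (filterᵇ p L) ≡ ∑ (λ x → f x * 𝟙 (p x)) L
∑-filterᵇ f p []      = refl
∑-filterᵇ f p (x ∷ L) with p x
... | true  = cong₂ _+_ (sym (*-identityʳ (f x))) (∑-filterᵇ f p L)
... | false = trans (∑-filterᵇ f p L) (cong (_+ ∑ (λ x → f x * 𝟙 (p x)) L) (sym (*-zeroʳ (f x))))

length≡∑ : {A : Set} (L : List A) → length L ≡ ∑ (λ _ → 1) L
length≡∑ []      = refl
length≡∑ (x ∷ L) = cong suc (length≡∑ L)

∑-allSubsets : ∀ {n} (f : Subset n → ℕ) → ∑ f (allSubsets n) ≡ ∫ 1 1 f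
∑-allSubsets {zero}  f = +-identityʳ (f [])
∑-allSubsets {suc n} f = begin
  ∑ f (map (true ∷_) A ++ map (false ∷_) A)
    ≡⟨ cong sum (map-++ f (map (true ∷_) A) (map (false ∷_) A)) ⟩
  sum (map f (map (true ∷_) A) ++ map f (map (false ∷_) A))
    ≡⟨ sum-++ (map f (map (true ∷_) A)) _ ⟩
  ∑ f (map (true ∷_) A) + ∑ f (map (false ∷_) A)
    ≡⟨ cong₂ (λ x y → sum x + sum y) (sym (map-∘ A)) (sym (map-∘ A)) ⟩
  ∑ (λ X → f (true ∷ X)) A + ∑ (λ X → f (false ∷ X)) A
    ≡⟨ cong₂ _+_ (trans (∑-allSubsets (λ X → f (true ∷ X))) (sym (*-identityˡ _)))
                 (trans (∑-allSubsets (λ X → f (false ∷ X))) (sym (*-identityˡ _))) ⟩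
  1 * ∫ 1 1 (λ X → f (true ∷ X)) + 1 * ∫ 1 1 (λ X → f (false ∷ X)) ∎
  where
  open ≡-Reasoning
  A = allSubsets n

card≡∫ : ∀ {n} (G : Family n) → card G ≡ ∫ 1 1 (λ X → 𝟙 (G X))
card≡∫ {n} G = begin
  length (filterᵇ G (allSubsets n))        ≡⟨ length≡∑ (filterᵇ G (allSubsets n)) ⟩
  ∑ (λ _ → 1) (filterᵇ G (allSubsets n))   ≡⟨ ∑-filterᵇ (λ _ → 1) G (allSubsets n) ⟩
  ∑ (λ X → 1 * 𝟙 (G X)) (allSubsets n)     ≡⟨ ∑-allSubsets (λ X → 1 * 𝟙 (G X)) ⟩
  ∫ 1 1 (λ X → 1 * 𝟙 (G X))                ≡⟨ ∫-cong 1 1 (λ X → *-identityˡ (𝟙 (G X))) ⟩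
  ∫ 1 1 (λ X → 𝟙 (G X)) ∎
  where open ≡-Reasoning

card-mono : ∀ {n} (G H : Family n) → G ⊆F H → card G ≤ card H
card-mono G H G⊆H rewrite card≡∫ G | card≡∫ H = ∫-mono 1 1 (λ X → 𝟙-mono (G⊆H X))

-- The bijection between `Y` disjoint from `X` and `Z = Y ∪ X` containing `X` is the change of
-- variable `∫-shift` at `N = 1`.
card-link : ∀ {n} (G : Family n) X → card (link G X) ≡ ∫ 1 1 (λ Z → 𝟙 (subsetᵇ X Z) * 𝟙 (G Z))
card-link G X = begin
  card (link G X)
    ≡⟨ card≡∫ (link G X) ⟩
  ∫ 1 1 (λ Y → 𝟙 (disjointᵇ Y X ∧ G (Y ∪ X)))
    ≡⟨ ∫-cong 1 1 (λ Y → 𝟙-∧ (disjointᵇ Y X) (G (Y ∪ X))) ⟩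
  ∫ 1 1 (λ Y → 𝟙 (disjointᵇ Y X) * 𝟙 (G (Y ∪ X)))
    ≡⟨ ∫-shift 1 X (λ Z → 𝟙 (G Z)) ⟩
  1 ^ ∣ X ∣ * ∫ 1 1 (λ Z → 𝟙 (subsetᵇ X Z) * 𝟙 (G Z))
    ≡⟨ cong (_* ∫ 1 1 (λ Z → 𝟙 (subsetᵇ X Z) * 𝟙 (G Z))) (^-zeroˡ ∣ X ∣) ⟩
  1 * ∫ 1 1 (λ Z → 𝟙 (subsetᵇ X Z) * 𝟙 (G Z))
    ≡⟨ *-identityˡ _ ⟩
  ∫ 1 1 (λ Z → 𝟙 (subsetᵇ X Z) * 𝟙 (G Z)) ∎
  where open ≡-Reasoning

card-link-mono : ∀ {n} (G H : Family n) X → G ⊆F H → card (link G X) ≤ card (link H X)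
card-link-mono G H X G⊆H rewrite card-link G X | card-link H X =
  ∫-mono 1 1 (λ Z → *-monoʳ-≤ (𝟙 (subsetᵇ X Z)) (𝟙-mono (G⊆H Z)))

card-link≤card : ∀ {n} (G : Family n) X → card (link G X) ≤ card G
card-link≤card G X rewrite card-link G X | card≡∫ G =
  ∫-mono 1 1 (λ Z → ≤-trans (*-monoˡ-≤ (𝟙 (G Z)) (𝟙≤1 (subsetᵇ X Z))) (≤-reflexive (*-identityˡ _)))

members : ∀ {n} → Family n → List (Subset n)
members {n} G = filterᵇ G (allSubsets n)

degree-members : ∀ {n} (G : Family n) X → degree (members G) X ≡ card (link G X)
degree-members {n} G X =
  trans (∑-filterᵇ (λ S → 𝟙 (subsetᵇ X S)) G (allSubsets n))
        (trans (∑-allSubsets (λ S → 𝟙 (subsetᵇ X S) * 𝟙 (G S))) (sym (card-link G X)))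

All-members : ∀ {n} (G : Family n) → All (λ X → T (G X)) (members G)
All-members {n} G = all-filter (λ X → T? (G X)) (allSubsets n)

∈-allSubsets : ∀ {n} (X : Subset n) → X ∈ allSubsets n
∈-allSubsets []                  = here refl
∈-allSubsets {suc n} (true ∷ X)  = ∈-++⁺ˡ (∈-map⁺ (true ∷_) (∈-allSubsets X))
∈-allSubsets {suc n} (false ∷ X) = ∈-++⁺ʳ (map (true ∷_) (allSubsets n)) (∈-map⁺ (false ∷_) (∈-allSubsets X))

-- Removing the members that meet a given set.

singletons : ∀ {n} → Subset n → List (Subset n)
singletons []          = []
singletons (true ∷ B)  = (true ∷ ⊥) ∷ map (false ∷_) (singletons B)
singletons (false ∷ B) = map (false ∷_) (singletons B)

length-singletons : ∀ {n} (B : Subset n) → length (singletons B) ≡ ∣ B ∣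
length-singletons []          = refl
length-singletons (true ∷ B)  = cong suc (trans (length-map _ (singletons B)) (length-singletons B))
length-singletons (false ∷ B) = trans (length-map _ (singletons B)) (length-singletons B)

∣singletons∣ : ∀ {n} (B : Subset n) → All (λ x → ∣ x ∣ ≡ 1) (singletons B)
∣singletons∣ []              = []
∣singletons∣ {suc n} (true ∷ B)  = cong suc (∣⊥∣≡0 n) ∷ map⁺ (∣singletons∣ B)
∣singletons∣ (false ∷ B)     = map⁺ (∣singletons∣ B)

disjoint-or-hit : ∀ {n} (S B : Subset n) → 1 ≤ 𝟙 (disjointᵇ S B) + ∑ (λ x → 𝟙 (subsetᵇ x S)) (singletons B)
disjoint-or-hit []          []          = ≤-refl
disjoint-or-hit (true ∷ S)  (true ∷ B)  = ≤-trans (≤-reflexive (sym (T⇒𝟙 (⊥⊆ S)))) (m≤m+n _ _)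
disjoint-or-hit (false ∷ S) (true ∷ B)  rewrite sym (map-∘ {g = λ x → 𝟙 (subsetᵇ x (false ∷ S))} {f = false ∷_} (singletons B)) = disjoint-or-hit S B
disjoint-or-hit (true ∷ S)  (false ∷ B) rewrite sym (map-∘ {g = λ x → 𝟙 (subsetᵇ x (true ∷ S))} {f = false ∷_} (singletons B)) = disjoint-or-hit S B
disjoint-or-hit (false ∷ S) (false ∷ B) rewrite sym (map-∘ {g = λ x → 𝟙 (subsetᵇ x (false ∷ S))} {f = false ∷_} (singletons B)) = disjoint-or-hit S B

avoiding : ∀ {n} → Subset n → Family n → Family n
avoiding B G S = G S ∧ disjointᵇ S B

-- Union bound: a member that meets `B` contains one of its singletons.
card≤avoiding+hits : ∀ {n} (G : Family n) B → card G ≤ card (avoiding B G) + ∑ (λ x → card (link G x)) (singletons B)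
card≤avoiding+hits G B = begin
  card G
    ≡⟨ card≡∫ G ⟩
  ∫ 1 1 (λ S → 𝟙 (G S))
    ≤⟨ ∫-mono 1 1 pointwise ⟩
  ∫ 1 1 (λ S → 𝟙 (avoiding B G S) + ∑ (λ x → 𝟙 (subsetᵇ x S) * 𝟙 (G S)) (singletons B))
    ≡⟨ ∫-+ 1 1 (λ S → 𝟙 (avoiding B G S)) (λ S → ∑ (λ x → 𝟙 (subsetᵇ x S) * 𝟙 (G S)) (singletons B)) ⟩
  ∫ 1 1 (λ S → 𝟙 (avoiding B G S)) + ∫ 1 1 (λ S → ∑ (λ x → 𝟙 (subsetᵇ x S) * 𝟙 (G S)) (singletons B))
    ≡⟨ cong₂ _+_ (sym (card≡∫ (avoiding B G))) (∫-∑ 1 1 (λ S x → 𝟙 (subsetᵇ x S) * 𝟙 (G S)) (singletons B)) ⟩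
  card (avoiding B G) + ∑ (λ x → ∫ 1 1 (λ S → 𝟙 (subsetᵇ x S) * 𝟙 (G S))) (singletons B)
    ≤⟨ +-monoʳ-≤ (card (avoiding B G)) (∑-mono (singletons B) (λ {x} _ → ≤-reflexive (sym (card-link G x)))) ⟩
  card (avoiding B G) + ∑ (λ x → card (link G x)) (singletons B) ∎
  where
  open ≤-Reasoning
  pointwise : ∀ S → 𝟙 (G S) ≤ 𝟙 (avoiding B G S) + ∑ (λ x → 𝟙 (subsetᵇ x S) * 𝟙 (G S)) (singletons B)
  pointwise S = begin
    𝟙 (G S)  ≡⟨ sym (*-identityˡ (𝟙 (G S))) ⟩
    1 * 𝟙 (G S)  ≤⟨ *-monoˡ-≤ (𝟙 (G S)) (disjoint-or-hit S B) ⟩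
    (𝟙 (disjointᵇ S B) + ∑ (λ x → 𝟙 (subsetᵇ x S)) (singletons B)) * 𝟙 (G S)
      ≡⟨ *-distribʳ-+ (𝟙 (G S)) (𝟙 (disjointᵇ S B)) _ ⟩
    𝟙 (disjointᵇ S B) * 𝟙 (G S) + ∑ (λ x → 𝟙 (subsetᵇ x S)) (singletons B) * 𝟙 (G S)
      ≡⟨ cong₂ _+_ (trans (*-comm (𝟙 (disjointᵇ S B)) (𝟙 (G S))) (sym (𝟙-∧ (G S) (disjointᵇ S B))))
                   (sym (∑-*ʳ (λ x → 𝟙 (subsetᵇ x S)) (𝟙 (G S)) (singletons B))) ⟩
    𝟙 (avoiding B G S) + ∑ (λ x → 𝟙 (subsetᵇ x S) * 𝟙 (G S)) (singletons B) ∎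

∑-const : {A : Set} (c : ℕ) (L : List A) → ∑ (λ _ → c) L ≡ length L * c
∑-const c []      = refl
∑-const c (x ∷ L) = cong (c +_) (∑-const c L)

Spreadℕ : ∀ {n} → ℕ → Family n → Set
Spreadℕ R G = ∀ X → card (link G X) * R ^ ∣ X ∣ ≤ card G

-- Spreadness at a singleton bounds each link by a `2 * q`-th part of `G`, and `B` has at most `q`
-- elements, so at most half of `G` meets `B`.
avoiding-half : ∀ {n} q .{{_ : NonZero q}} (G : Family n) B → ∣ B ∣ ≤ q → Spreadℕ (2 * q) G →
  card G ≤ 2 * card (avoiding B G)
avoiding-half q G B ∣B∣≤q spread = +-cancelʳ-≤ (card G) (card G) (2 * card (avoiding B G)) (begin
  card G + card G          ≡⟨ double (card G) ⟩
  2 * card G               ≤⟨ *-monoʳ-≤ 2 (card≤avoiding+hits G B) ⟩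
  2 * (card (avoiding B G) + hits)  ≡⟨ *-distribˡ-+ 2 (card (avoiding B G)) hits ⟩
  2 * card (avoiding B G) + 2 * hits  ≤⟨ +-monoʳ-≤ (2 * card (avoiding B G)) few-hits ⟩
  2 * card (avoiding B G) + card G ∎)
  where
  open ≤-Reasoning
  hits = ∑ (λ x → card (link G x)) (singletons B)
  double : ∀ c → c + c ≡ 2 * c
  double = solve-∀
  arith : ∀ q h → q * (2 * h) ≡ h * (2 * q)
  arith = solve-∀
  one : ∀ {x} → x ∈ singletons B → card (link G x) * (2 * q) ≤ card G
  one {x} x∈ = begin
    card (link G x) * (2 * q)          ≡⟨ cong (card (link G x) *_) (sym (^-identityʳ (2 * q))) ⟩
    card (link G x) * (2 * q) ^ 1      ≡⟨ cong (λ d → card (link G x) * (2 * q) ^ d) (sym (All.lookup (∣singletons∣ B) x∈)) ⟩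
    card (link G x) * (2 * q) ^ ∣ x ∣  ≤⟨ spread x ⟩
    card G ∎
  few-hits : 2 * hits ≤ card G
  few-hits = *-cancelˡ-≤ q (begin
    q * (2 * hits)                                          ≡⟨ arith q hits ⟩
    hits * (2 * q)                                          ≡⟨ sym (∑-*ʳ (λ x → card (link G x)) (2 * q) (singletons B)) ⟩
    ∑ (λ x → card (link G x) * (2 * q)) (singletons B)      ≤⟨ ∑-mono (singletons B) one ⟩
    ∑ (λ _ → card G) (singletons B)                         ≡⟨ ∑-const (card G) (singletons B) ⟩
    length (singletons B) * card G                          ≡⟨ cong (_* card G) (length-singletons B) ⟩
    ∣ B ∣ * card G                                          ≤⟨ *-monoˡ-≤ (card G) ∣B∣≤q ⟩
    q * card G ∎)

-- For nonempty `X` the factor `2 ^ ∣ X ∣ ≥ 2` repays the lost half. For empty `X` the bound only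
-- says that a link is no larger than its family.
halving-spread : ∀ {n} R (G H : Family n) → H ⊆F G → card G ≤ 2 * card H → Spreadℕ (2 * R) G → Spreadℕ R H
halving-spread R G H H⊆G half spread X with ∣ X ∣ in eq
... | zero  = ≤-trans (≤-reflexive (*-identityʳ _)) (card-link≤card H X)
... | suc d = *-cancelˡ-≤ 2 (begin
  2 * (card (link H X) * R ^ suc d)            ≤⟨ *-monoʳ-≤ 2 (*-monoˡ-≤ (R ^ suc d) (card-link-mono H G X H⊆G)) ⟩
  2 * (card (link G X) * R ^ suc d)            ≤⟨ *-monoˡ-≤ (card (link G X) * R ^ suc d) (m≤m*n 2 (2 ^ d) {{m^n≢0 2 d}}) ⟩
  2 ^ suc d * (card (link G X) * R ^ suc d)    ≡⟨ arith (2 ^ suc d) (card (link G X)) (R ^ suc d) ⟩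
  card (link G X) * (2 ^ suc d * R ^ suc d)    ≡⟨ cong (card (link G X) *_) (sym (^-distribʳ-* (suc d) 2 R)) ⟩
  card (link G X) * (2 * R) ^ suc d            ≡⟨ cong (λ e → card (link G X) * (2 * R) ^ e) (sym eq) ⟩
  card (link G X) * (2 * R) ^ ∣ X ∣            ≤⟨ spread X ⟩
  card G                                       ≤⟨ half ⟩
  2 * card H ∎)
  where
  open ≤-Reasoning
  arith : ∀ t c p → t * (c * p) ≡ c * (t * p)
  arith = solve-∀

-- Intersection of two sets with spread links.

∪∩∪-disjoint : ∀ {n} (X Y B₁ B₂ : Subset n) → T (disjointᵇ X B₁) → T (disjointᵇ X B₂) →
  T (disjointᵇ Y B₁) → T (disjointᵇ Y B₂) → T (disjointᵇ X Y) → (X ∪ B₁) ∩ (Y ∪ B₂) ≡ B₁ ∩ B₂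
∪∩∪-disjoint []          []          []           []           a b c d e = refl
∪∩∪-disjoint (true ∷ X)  (false ∷ Y) (false ∷ B₁) (false ∷ B₂) a b c d e = cong (false ∷_) (∪∩∪-disjoint X Y B₁ B₂ a b c d e)
∪∩∪-disjoint (false ∷ X) (true ∷ Y)  (false ∷ B₁) (false ∷ B₂) a b c d e = cong (false ∷_) (∪∩∪-disjoint X Y B₁ B₂ a b c d e)
∪∩∪-disjoint (false ∷ X) (false ∷ Y) (x ∷ B₁)     (y ∷ B₂)     a b c d e = cong (x ∧ y ∷_) (∪∩∪-disjoint X Y B₁ B₂ a b c d e)

⊆-∪ˡ : ∀ {n} (X W : Subset n) → T (subsetᵇ X (X ∪ W))
⊆-∪ˡ []          []      = _
⊆-∪ˡ (true ∷ X)  (_ ∷ W) = ⊆-∪ˡ X W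
⊆-∪ˡ (false ∷ X) (_ ∷ W) = ⊆-∪ˡ X W

module _ {n : ℕ} (k m q : ℕ) .{{_ : NonZero m}} .{{_ : NonZero q}} (k<2^m : k < 2 ^ m) where

  -- The two spread hypotheses serve different ends: `2 * q` lets half of the link survive the
  -- removal of members meeting `C`, and `2 * (2048 * m)` leaves the survivors `2048 * m`-spread.
  avoiding-covers : (F : Family n) (B C : Subset n) → (∀ X → T (F X) → ∣ X ∣ ≤ k) → ∣ C ∣ ≤ q →
    0 < card (link F B) → Spreadℕ (2 * q) (link F B) → Spreadℕ (2 * (2048 * m)) (link F B) →
    2 ^ n < 2 * ∫ 1 1 (λ U → 𝟙 (covers (members (avoiding C (link F B))) U))
  avoiding-covers F B C F≤k ∣C∣≤q nonempty spread₁ spread₂ =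
    random-half-covers m (members H) H>0 small
      (λ X → ≤-trans (≤-reflexive (cong (_* (2048 * m) ^ ∣ X ∣) (degree-members H X)))
                     (halving-spread (2048 * m) G H H⊆G half spread₂ X))
    where
    G H : Family n
    G = link F B
    H = avoiding C G
    half : card G ≤ 2 * card H
    half = avoiding-half q G C ∣C∣≤q spread₁
    H>0 : 0 < card H
    H>0 = *-cancelˡ-< 2 0 (card H) (≤-trans nonempty half)
    H⊆G : H ⊆F G
    H⊆G X p = proj₁ (Equivalence.to T-∧ p)
    small : All (λ S → ∣ S ∣ < 2 ^ m) (members H)
    small = All.map (λ {S} p → ≤-trans (s≤s (≤-trans (⊆⇒∣∣≤ S (S ∪ B) (⊆-∪ˡ S B))
      (F≤k (S ∪ B) (proj₂ (Equivalence.to T-∧ (H⊆G S p)))))) k<2^m) (All-members H)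

  -- Disjoint `X` and `Y` from the two links, both avoiding `B₁` and `B₂`, extend to members of `F₁`
  -- and `F₂` that meet exactly in `B₁ ∩ B₂`. The case `B₁ = B₂` is included.
  cross-intersection : ∀ t (F₁ F₂ : Family n) (B₁ B₂ : Subset n) →
    (∀ X → T (F₁ X) → ∣ X ∣ ≤ k) → (∀ X → T (F₂ X) → ∣ X ∣ ≤ k) →
    (∀ X Y → T (F₁ X) → T (F₂ Y) → t ≤ ∣ X ∩ Y ∣) →
    ∣ B₁ ∣ ≤ q → ∣ B₂ ∣ ≤ q → 0 < card (link F₁ B₁) → 0 < card (link F₂ B₂) →
    Spreadℕ (2 * q) (link F₁ B₁) → Spreadℕ (2 * (2048 * m)) (link F₁ B₁) →
    Spreadℕ (2 * q) (link F₂ B₂) → Spreadℕ (2 * (2048 * m)) (link F₂ B₂) →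
    t ≤ ∣ B₁ ∩ B₂ ∣
  cross-intersection t F₁ F₂ B₁ B₂ F₁≤k F₂≤k cross B₁≤q B₂≤q ne₁ ne₂ s₁ s₁′ s₂ s₂′ =
    let X , Y , X∈ , Y∈ , X∩Y=∅ =
          disjoint-members (members (avoiding B₂ (link F₁ B₁))) (members (avoiding B₁ (link F₂ B₂)))
            (avoiding-covers F₁ B₁ B₂ F₁≤k B₂≤q ne₁ s₁ s₁′) (avoiding-covers F₂ B₂ B₁ F₂≤k B₁≤q ne₂ s₂ s₂′)
        X∈link , X∩B₂=∅ = Equivalence.to T-∧ (All.lookup (All-members (avoiding B₂ (link F₁ B₁))) X∈)
        Y∈link , Y∩B₁=∅ = Equivalence.to T-∧ (All.lookup (All-members (avoiding B₁ (link F₂ B₂))) Y∈)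
        X∩B₁=∅ , X∪B₁∈F₁ = Equivalence.to T-∧ X∈link
        Y∩B₂=∅ , Y∪B₂∈F₂ = Equivalence.to T-∧ Y∈link
    in subst (λ Z → t ≤ ∣ Z ∣) (∪∩∪-disjoint X Y B₁ B₂ X∩B₁=∅ X∩B₂=∅ Y∩B₁=∅ Y∩B₂=∅ X∩Y=∅)
             (cross (X ∪ B₁) (Y ∪ B₂) X∪B₁∈F₁ Y∪B₂∈F₂)

-- Here `m` is the integer part of log₂ k plus one. The upper estimate bounds `m` by log₂ (2k); the
-- lower one puts sets of size `k` strictly below `2 ^ m`.
∃-log : ∀ k → 1 ≤ k → ∃ λ m → 1 ≤ m × 2 ^ m ≤ 2 * k × k < 2 ^ m
∃-log (suc zero)    _ = 1 , ≤-refl , ≤-refl , ≤-refl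
∃-log (suc (suc k)) _ with ∃-log (suc k) (s≤s z≤n)
... | m , 1≤m , lower , upper with suc (suc k) <? 2 ^ m
...   | yes p = m , 1≤m , ≤-trans lower (*-monoʳ-≤ 2 (n≤1+n (suc k))) , p
...   | no ¬p = suc m , s≤s z≤n , ≤-reflexive (cong (2 *_) (sym eq)) , (begin-strict
        suc (suc k)   ≡⟨ eq ⟩
        2 ^ m         <⟨ m<m*n (2 ^ m) 2 {{m^n≢0 2 m}} (s≤s (s≤s z≤n)) ⟩
        2 ^ m * 2     ≡⟨ *-comm (2 ^ m) 2 ⟩
        2 ^ suc m ∎)
  where
  open ≤-Reasoning
  eq : suc (suc k) ≡ 2 ^ m
  eq = ≤-antisym upper (≮⇒≥ ¬p)

-- From rational to natural spread parameters.

ℕtoℚ≡mkℚ : ∀ m → ℕtoℚ m ≡ mkℚ (ℤ.+ m) 0 (Coprimality.sym (Coprimality.1-coprimeTo m))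
ℕtoℚ≡mkℚ m = ℚ.normalize-coprime (Coprimality.sym (Coprimality.1-coprimeTo m))

ℕtoℚ-mono-≤ : ∀ {m n} → m ≤ n → ℕtoℚ m ℚ.≤ ℕtoℚ n
ℕtoℚ-mono-≤ {m} {n} m≤n rewrite ℕtoℚ≡mkℚ m | ℕtoℚ≡mkℚ n = *≤* (ℤ.*-monoʳ-≤-nonNeg (ℤ.+ 1) (ℤ.+≤+ m≤n))

ℕtoℚ-cancel-≤ : ∀ {m n} → ℕtoℚ m ℚ.≤ ℕtoℚ n → m ≤ n
ℕtoℚ-cancel-≤ {m} {n} p rewrite ℕtoℚ≡mkℚ m | ℕtoℚ≡mkℚ n =
  ℤ.drop‿+≤+ (ℤ.*-cancelʳ-≤-pos (ℤ.+ m) (ℤ.+ n) (ℤ.+ 1) (ℚ.drop-*≤* p))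

ℕtoℚ-* : ∀ m n → ℕtoℚ (m * n) ≡ ℕtoℚ m ℚ.* ℕtoℚ n
ℕtoℚ-* m n rewrite ℕtoℚ≡mkℚ m | ℕtoℚ≡mkℚ n | ℕtoℚ≡mkℚ (m * n) = ℚ.toℚᵘ-injective
  (ℚᵘ.≃-trans (*≡* (cong (ℤ._* ℤ.+ 1) (ℤ.pos-* m n)))
              (ℚᵘ.≃-sym (ℚ.toℚᵘ-homo-* (mkℚ (ℤ.+ m) 0 (Coprimality.sym (Coprimality.1-coprimeTo m))) (mkℚ (ℤ.+ n) 0 (Coprimality.sym (Coprimality.1-coprimeTo n))))))

ℕtoℚ-^ : ∀ m d → ℕtoℚ (m ^ d) ≡ ℕtoℚ m ^ℚ d
ℕtoℚ-^ m zero    = refl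
ℕtoℚ-^ m (suc d) = trans (ℕtoℚ-* m (m ^ d)) (cong (ℕtoℚ m ℚ.*_) (ℕtoℚ-^ m d))

ℕtoℚ-nonNeg : ∀ m → NonNegative (ℕtoℚ m)
ℕtoℚ-nonNeg m rewrite ℕtoℚ≡mkℚ m = _

^ℚ-nonNeg : ∀ p d .{{_ : NonNegative p}} → NonNegative (p ^ℚ d)
^ℚ-nonNeg p zero    = _
^ℚ-nonNeg p (suc d) = ℚ.nonNeg*nonNeg⇒nonNeg p (p ^ℚ d) {{^ℚ-nonNeg p d}}

^ℚ-pos : ∀ p d .{{_ : Positive p}} → Positive (p ^ℚ d)
^ℚ-pos p zero    = _
^ℚ-pos p (suc d) = ℚ.pos*pos⇒pos p (p ^ℚ d) {{^ℚ-pos p d}}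

^ℚ-mono : ∀ {p r} d .{{_ : NonNegative p}} .{{_ : NonNegative r}} → p ℚ.≤ r → p ^ℚ d ℚ.≤ r ^ℚ d
^ℚ-mono zero          p≤r = ℚ.≤-refl
^ℚ-mono {p} {r} (suc d) p≤r = ℚ.≤-trans
  (ℚ.*-monoʳ-≤-nonNeg (p ^ℚ d) {{^ℚ-nonNeg p d}} p≤r)
  (ℚ.*-monoˡ-≤-nonNeg r (^ℚ-mono d p≤r))

^ℚ-distribˡ-+-* : ∀ p d e → p ^ℚ (d + e) ≡ p ^ℚ d ℚ.* p ^ℚ e
^ℚ-distribˡ-+-* p zero    e = sym (ℚ.*-identityˡ (p ^ℚ e))
^ℚ-distribˡ-+-* p (suc d) e =
  trans (cong (p ℚ.*_) (^ℚ-distribˡ-+-* p d e)) (sym (ℚ.*-assoc p (p ^ℚ d) (p ^ℚ e)))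

Spread⇒Spreadℕ : ∀ {n} N r .{{_ : NonNegative r}} (G : Family n) → ℕtoℚ N ℚ.≤ r → Spread r G → Spreadℕ N G
Spread⇒Spreadℕ N r G N≤r spread X = ℕtoℚ-cancel-≤ (begin
  ℕtoℚ (c * N ^ ∣ X ∣)             ≡⟨ ℕtoℚ-* c (N ^ ∣ X ∣) ⟩
  ℕtoℚ c ℚ.* ℕtoℚ (N ^ ∣ X ∣)      ≡⟨ cong (ℕtoℚ c ℚ.*_) (ℕtoℚ-^ N ∣ X ∣) ⟩
  ℕtoℚ c ℚ.* ℕtoℚ N ^ℚ ∣ X ∣       ≤⟨ ℚ.*-monoˡ-≤-nonNeg (ℕtoℚ c) {{ℕtoℚ-nonNeg c}} (^ℚ-mono ∣ X ∣ {{ℕtoℚ-nonNeg N}} N≤r) ⟩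
  ℕtoℚ c ℚ.* r ^ℚ ∣ X ∣            ≤⟨ spread X ⟩
  ℕtoℚ (card G) ∎)
  where
  open ℚ.≤-Reasoning
  c = card (link G X)

2^-cancel-< : ∀ a b → 2 ^ a < 2 ^ b → a < b
2^-cancel-< a b p = ≰⇒> (λ b≤a → <⇒≱ p (^-monoʳ-≤ 2 b≤a))

-- With `r = a / suc d`, the chain `2 ^ (m * (4096 * suc d)) ≤ (2 * k) ^ (4096 * suc d) < 2 ^
-- a` compares exponents, and `4096` is `2 * 2048`.
LogBound⇒≤ : ∀ k m r → 2 ^ m ≤ 2 * k → 1ℚ ℚ.≤ r → LogBound k r → ℕtoℚ (2 * (2048 * m)) ℚ.≤ r
-- `LogBound` sees only the absolute value of the numerator, so negative `r` is excluded by `1 ≤ r`.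
LogBound⇒≤ k m (mkℚ -[1+ a ] d c) 2^m≤2k (*≤* ()) logBound
LogBound⇒≤ k m (mkℚ (ℤ.+ a) d c) 2^m≤2k 1≤r logBound = subst (ℚ._≤ mkℚ (ℤ.+ a) d c) (sym (ℕtoℚ≡mkℚ (2 * (2048 * m)))) (*≤* (begin
  ℤ.+ (2 * (2048 * m)) ℤ.* ℤ.+ suc d  ≡⟨ sym (ℤ.pos-* (2 * (2048 * m)) (suc d)) ⟩
  ℤ.+ (2 * (2048 * m) * suc d)      ≡⟨ cong ℤ.+_ (arith m (suc d)) ⟩
  ℤ.+ (m * (4096 * suc d))          ≤⟨ ℤ.+≤+ (<⇒≤ (2^-cancel-< (m * (4096 * suc d)) a
      (≤-<-trans (≤-reflexive (sym (^-*-assoc 2 m (4096 * suc d))))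
                 (≤-<-trans (^-monoˡ-≤ (4096 * suc d) 2^m≤2k) logBound)))) ⟩
  ℤ.+ a                             ≡⟨ sym (ℤ.*-identityʳ (ℤ.+ a)) ⟩
  ℤ.+ a ℤ.* ℤ.+ 1 ∎))
  where
  open ℤ.≤-Reasoning
  arith : ∀ m d → 2 * (2048 * m) * d ≡ m * (4096 * d)
  arith = solve-∀

-- Iterated links and the densest set of a family.

disjointᵇ-⊆ : ∀ {n} (Y Z X : Subset n) → T (disjointᵇ (Z ∪ Y) X) → T (disjointᵇ Y X)
disjointᵇ-⊆ []          []          []          p = _
disjointᵇ-⊆ (true ∷ Y)  (true ∷ Z)  (false ∷ X) p = disjointᵇ-⊆ Y Z X p
disjointᵇ-⊆ (true ∷ Y)  (false ∷ Z) (false ∷ X) p = disjointᵇ-⊆ Y Z X p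
disjointᵇ-⊆ (false ∷ Y) (true ∷ Z)  (false ∷ X) p = disjointᵇ-⊆ Y Z X p
disjointᵇ-⊆ (false ∷ Y) (false ∷ Z) (_ ∷ X)     p = disjointᵇ-⊆ Y Z X p

disjointᵇ-∪ : ∀ {n} (W Y X : Subset n) → T (disjointᵇ W Y) → T (disjointᵇ (W ∪ Y) X) → T (disjointᵇ W (Y ∪ X))
disjointᵇ-∪ []          []          []          p p′ = _
disjointᵇ-∪ (true ∷ W)  (false ∷ Y) (false ∷ X) p p′ = disjointᵇ-∪ W Y X p p′
disjointᵇ-∪ (false ∷ W) (true ∷ Y)  (false ∷ X) p p′ = disjointᵇ-∪ W Y X p p′
disjointᵇ-∪ (false ∷ W) (false ∷ Y) (_ ∷ X)     p p′ = disjointᵇ-∪ W Y X p p′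

∣∪∣-disjoint : ∀ {n} (Y X : Subset n) → T (disjointᵇ Y X) → ∣ Y ∪ X ∣ ≡ ∣ Y ∣ + ∣ X ∣
∣∪∣-disjoint []          []          p = refl
∣∪∣-disjoint (true ∷ Y)  (false ∷ X) p = cong suc (∣∪∣-disjoint Y X p)
∣∪∣-disjoint (false ∷ Y) (true ∷ X)  p = trans (cong suc (∣∪∣-disjoint Y X p)) (sym (+-suc ∣ Y ∣ ∣ X ∣))
∣∪∣-disjoint (false ∷ Y) (false ∷ X) p = ∣∪∣-disjoint Y X p

link-link-⊆ : ∀ {n} (H : Family n) X Y → link (link H X) Y ⊆F link H (Y ∪ X)
link-link-⊆ H X Y W p =
  let W∩Y=∅ , p′ = Equivalence.to T-∧ p
      W∪Y∩X=∅ , p″ = Equivalence.to T-∧ p′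
  in Equivalence.from T-∧ (disjointᵇ-∪ W Y X W∩Y=∅ W∪Y∩X=∅ , subst (T ∘ H) (∪-assoc W Y X) p″)

card-empty : ∀ {n} (G : Family n) → (∀ X → ¬ T (G X)) → card G ≡ 0
card-empty {n} G empty = n≤0⇒n≡0 (≤-trans (≤-reflexive (card≡∫ G))
  (≤-trans (∫-mono 1 1 (λ X → 𝟙-mono {b = false} (empty X))) (≤-reflexive (∫-const {n} 1 1 0))))

card-link-⊥ : ∀ {n} (G : Family n) → card (link G ⊥) ≡ card G
card-link-⊥ G = trans (card-link G ⊥) (trans
  (∫-cong 1 1 (λ Z → trans (cong (_* 𝟙 (G Z)) (T⇒𝟙 (⊥⊆ Z))) (*-identityˡ (𝟙 (G Z))))) (sym (card≡∫ G)))

T-stable : ∀ b → ¬ T (not b) → T b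
T-stable true  _ = _
T-stable false h = h _

_without_ : ∀ {n} → Family n → Subset n → Family n
(H without X) Y = H Y ∧ not (subsetᵇ X Y)

card-without : ∀ {n} (H : Family n) X → card H ≡ card (link H X) + card (H without X)
card-without H X = begin
  card H                 ≡⟨ card≡∫ H ⟩
  ∫ 1 1 (λ Y → 𝟙 (H Y))  ≡⟨ ∫-cong 1 1 (λ Y → cases (H Y) (subsetᵇ X Y)) ⟩
  ∫ 1 1 (λ Y → 𝟙 (subsetᵇ X Y) * 𝟙 (H Y) + 𝟙 ((H without X) Y))
    ≡⟨ ∫-+ 1 1 (λ Y → 𝟙 (subsetᵇ X Y) * 𝟙 (H Y)) (λ Y → 𝟙 ((H without X) Y)) ⟩
  ∫ 1 1 (λ Y → 𝟙 (subsetᵇ X Y) * 𝟙 (H Y)) + ∫ 1 1 (λ Y → 𝟙 ((H without X) Y))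
    ≡⟨ cong₂ _+_ (sym (card-link H X)) (sym (card≡∫ (H without X))) ⟩
  card (link H X) + card (H without X) ∎
  where
  open ≡-Reasoning
  cases : ∀ h s → 𝟙 h ≡ 𝟙 s * 𝟙 h + 𝟙 (h ∧ not s)
  cases true  true  = refl
  cases true  false = refl
  cases false true  = refl
  cases false false = refl

module _ {n : ℕ} (r : ℚ) .{{r>0 : Positive r}} where

  private
    r≥0 : NonNegative r
    r≥0 = ℚ.pos⇒nonNeg r {{r>0}}

  density : Family n → Subset n → ℚ
  density H X = ℕtoℚ (card (link H X)) ℚ.* r ^ℚ ∣ X ∣

  densest : Family n → Subset n
  densest H = argmax (density H) ⊥ (allSubsets n)

  density-max : ∀ H Y → density H Y ℚ.≤ density H (densest H)
  density-max H Y = All.lookup {P = λ Z → density H Z ℚ.≤ density H (densest H)}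
    (f[xs]≤f[argmax] {f = density H} ⊥ (allSubsets n)) (∈-allSubsets Y)

  -- Compare the maximum with the density at `⊥`, which is the size of `H`.
  card≤density : ∀ H → ℕtoℚ (card H) ℚ.≤ density H (densest H)
  card≤density H = subst (ℚ._≤ density H (densest H)) density-⊥ (density-max H ⊥)
    where
    density-⊥ : density H ⊥ ≡ ℕtoℚ (card H)
    density-⊥ = trans (cong₂ (λ c d → ℕtoℚ c ℚ.* r ^ℚ d) (card-link-⊥ H) (∣⊥∣≡0 n)) (ℚ.*-identityʳ (ℕtoℚ (card H)))

  -- If `Y` meets `X`, the iterated link is empty. Otherwise it embeds in the link at `Y ∪ X`, whose
  -- density is at most that of `X`; dividing by `r ^ℚ ∣ X ∣` leaves the bound.
  densest-spread : ∀ H → Spread r (link H (densest H))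
  densest-spread H Y = by-cases (T? (disjointᵇ Y X))
    where
    X = densest H
    by-cases : Dec (T (disjointᵇ Y X)) → ℕtoℚ (card (link (link H X) Y)) ℚ.* r ^ℚ ∣ Y ∣ ℚ.≤ ℕtoℚ (card (link H X))
    by-cases (no meets) = subst (λ c → ℕtoℚ c ℚ.* r ^ℚ ∣ Y ∣ ℚ.≤ ℕtoℚ (card (link H X)))
          (sym (card-empty (link (link H X) Y) (λ W p → meets (disjointᵇ-⊆ Y W X
            (proj₁ (Equivalence.to T-∧ (proj₂ (Equivalence.to (T-∧ {x = disjointᵇ W Y}) p))))))))
          (subst (ℚ._≤ ℕtoℚ (card (link H X))) (sym (ℚ.*-zeroˡ (r ^ℚ ∣ Y ∣)))
                 (ℚ.nonNegative⁻¹ (ℕtoℚ (card (link H X))) {{ℕtoℚ-nonNeg (card (link H X))}}))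
    by-cases (yes Y∩X=∅) = ℚ.*-cancelʳ-≤-pos (r ^ℚ ∣ X ∣) {{^ℚ-pos r ∣ X ∣ {{r>0}}}} (begin
      ℕtoℚ (card (link (link H X) Y)) ℚ.* r ^ℚ ∣ Y ∣ ℚ.* r ^ℚ ∣ X ∣
        ≡⟨ ℚ.*-assoc (ℕtoℚ (card (link (link H X) Y))) (r ^ℚ ∣ Y ∣) (r ^ℚ ∣ X ∣) ⟩
      ℕtoℚ (card (link (link H X) Y)) ℚ.* (r ^ℚ ∣ Y ∣ ℚ.* r ^ℚ ∣ X ∣)
        ≡⟨ cong (ℕtoℚ (card (link (link H X) Y)) ℚ.*_) (sym (trans (cong (r ^ℚ_) (∣∪∣-disjoint Y X Y∩X=∅)) (^ℚ-distribˡ-+-* r ∣ Y ∣ ∣ X ∣))) ⟩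
      ℕtoℚ (card (link (link H X) Y)) ℚ.* r ^ℚ ∣ Y ∪ X ∣
        ≤⟨ ℚ.*-monoʳ-≤-nonNeg (r ^ℚ ∣ Y ∪ X ∣) {{^ℚ-nonNeg r ∣ Y ∪ X ∣ {{r≥0}}}}
             (ℕtoℚ-mono-≤ (card-mono (link (link H X) Y) (link H (Y ∪ X)) (link-link-⊆ H X Y))) ⟩
      density H (Y ∪ X)
        ≤⟨ density-max H (Y ∪ X) ⟩
      ℕtoℚ (card (link H X)) ℚ.* r ^ℚ ∣ X ∣ ∎)
      where open ℚ.≤-Reasoning

  densest-nonempty : ∀ H → 0 < card H → 0 < card (link H (densest H))
  densest-nonempty H H>0 = n≢0⇒n>0 λ empty → <⇒≱ H>0 (ℕtoℚ-cancel-≤ (ℚ.≤-trans (card≤density H)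
    (ℚ.≤-reflexive (trans (cong (λ c → ℕtoℚ c ℚ.* r ^ℚ ∣ densest H ∣) empty) (ℚ.*-zeroˡ (r ^ℚ ∣ densest H ∣))))))

  -- With `s = ∣ X ∣`, maximality and the spreadness of `A` give |H| ≤ r^s |A(X)| ≤ (r/r₀)^s |A|.
  -- Since `r ≤ r₀`, the exponent may be lowered to `suc q`: the excess `r ^ℚ d` is replaced by
  -- `r₀ ^ℚ d`, which then cancels.
  card-bound : ∀ r₀ .{{r₀>0 : Positive r₀}} (A H : Family n) q → r ℚ.≤ r₀ → Spread r₀ A → H ⊆F A → q < ∣ densest H ∣ →
    ℕtoℚ (card H) ℚ.* r₀ ^ℚ suc q ℚ.≤ r ^ℚ suc q ℚ.* ℕtoℚ (card A)
  card-bound r₀ {{r₀>0}} A H q r≤r₀ spread H⊆A q<s = ℚ.*-cancelʳ-≤-pos (r₀ ^ℚ d) {{^ℚ-pos r₀ d {{r₀>0}}}} (begin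
    h ℚ.* r₀ ^ℚ suc q ℚ.* r₀ ^ℚ d      ≡⟨ ℚ.*-assoc h (r₀ ^ℚ suc q) (r₀ ^ℚ d) ⟩
    h ℚ.* (r₀ ^ℚ suc q ℚ.* r₀ ^ℚ d)    ≡⟨ cong (h ℚ.*_) (sym (power r₀)) ⟩
    h ℚ.* r₀ ^ℚ s                      ≤⟨ ℚ.*-monoʳ-≤-nonNeg (r₀ ^ℚ s) {{^ℚ-nonNeg r₀ s {{r₀≥0}}}} (card≤density H) ⟩
    ℕtoℚ (card (link H X)) ℚ.* r ^ℚ s ℚ.* r₀ ^ℚ s
      ≤⟨ ℚ.*-monoʳ-≤-nonNeg (r₀ ^ℚ s) {{^ℚ-nonNeg r₀ s {{r₀≥0}}}} (ℚ.*-monoʳ-≤-nonNeg (r ^ℚ s) {{^ℚ-nonNeg r s {{r≥0}}}}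
           (ℕtoℚ-mono-≤ (card-link-mono H A X H⊆A))) ⟩
    c ℚ.* r ^ℚ s ℚ.* r₀ ^ℚ s           ≡⟨ swap c (r ^ℚ s) (r₀ ^ℚ s) ⟩
    r ^ℚ s ℚ.* (c ℚ.* r₀ ^ℚ s)         ≤⟨ ℚ.*-monoˡ-≤-nonNeg (r ^ℚ s) {{^ℚ-nonNeg r s {{r≥0}}}} (spread X) ⟩
    r ^ℚ s ℚ.* a                       ≡⟨ cong (ℚ._* a) (power r) ⟩
    r ^ℚ suc q ℚ.* r ^ℚ d ℚ.* a
      ≤⟨ ℚ.*-monoʳ-≤-nonNeg a {{ℕtoℚ-nonNeg (card A)}} (ℚ.*-monoˡ-≤-nonNeg (r ^ℚ suc q) {{^ℚ-nonNeg r (suc q) {{r≥0}}}} (^ℚ-mono d {{r≥0}} {{r₀≥0}} r≤r₀)) ⟩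
    r ^ℚ suc q ℚ.* r₀ ^ℚ d ℚ.* a       ≡⟨ swap′ (r ^ℚ suc q) (r₀ ^ℚ d) a ⟩
    r ^ℚ suc q ℚ.* a ℚ.* r₀ ^ℚ d ∎)
    where
    open ℚ.≤-Reasoning
    open ℚ.+-*-Solver using (solve; _:=_; _:*_)
    r₀≥0 : NonNegative r₀
    r₀≥0 = ℚ.pos⇒nonNeg r₀ {{r₀>0}}
    X = densest H
    s = ∣ X ∣
    d = s ℕ.∸ suc q
    h = ℕtoℚ (card H)
    a = ℕtoℚ (card A)
    c = ℕtoℚ (card (link A X))
    power : ∀ p → p ^ℚ s ≡ p ^ℚ suc q ℚ.* p ^ℚ d
    power p = trans (cong (p ^ℚ_) (sym (m+[n∸m]≡n q<s))) (^ℚ-distribˡ-+-* p (suc q) d)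
    swap : ∀ x y z → x ℚ.* y ℚ.* z ≡ y ℚ.* (x ℚ.* z)
    swap = solve 3 (λ x y z → x :* y :* z := y :* (x :* z)) refl
    swap′ : ∀ x y z → x ℚ.* y ℚ.* z ≡ x ℚ.* z ℚ.* y
    swap′ = solve 3 (λ x y z → x :* y :* z := x :* z :* y) refl

-- Greedy extraction.

zero-bound : ∀ c a p s .{{_ : NonNegative s}} → c ≡ 0 → ℕtoℚ c ℚ.* p ℚ.≤ s ℚ.* ℕtoℚ a
zero-bound _ a p s refl = subst (ℚ._≤ s ℚ.* ℕtoℚ a) (sym (ℚ.*-zeroˡ p))
  (ℚ.nonNegative⁻¹ (s ℚ.* ℕtoℚ a) {{ℚ.nonNeg*nonNeg⇒nonNeg s (ℕtoℚ a) {{ℕtoℚ-nonNeg a}}}})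

module _ {n : ℕ} (A F : Family n) (q : ℕ) (r r₀ : ℚ) .{{r>0 : Positive r}} .{{r₀>0 : Positive r₀}}
         (F⊆A : F ⊆F A) (r≤r₀ : r ℚ.≤ r₀) (spread : Spread r₀ A) where

  -- Nonemptiness of the link is recorded because an empty family is spread for every parameter and
  -- would say nothing about intersections.
  Witness : Subset n → Set
  Witness B = ∣ B ∣ ≤ q × Σ (Family n) λ F_B → (F_B ⊆F F) × Spread r (link F_B B) × 0 < card (link F_B B)

  -- The current family `H` varies so that the extraction can recurse, while the witnesses refer to
  -- the fixed `F`.
  Approximation : Family n → Set
  Approximation H = Σ (Family n) λ S → Σ (Family n) λ F′ →
    ((B : Subset n) → T (S B) → Witness B) ×
    (F′ ⊆F H) ×
    ((X : Subset n) → T (H X) → T (not (F′ X)) → Σ (Subset n) λ B → T (S B) × T (subsetᵇ B X)) ×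
    (ℕtoℚ (card F′) ℚ.* r₀ ^ℚ suc q ℚ.≤ r ^ℚ suc q ℚ.* ℕtoℚ (card A))

  stop : (H : Family n) → ℕtoℚ (card H) ℚ.* r₀ ^ℚ suc q ℚ.≤ r ^ℚ suc q ℚ.* ℕtoℚ (card A) → Approximation H
  stop H bound = (λ _ → false) , H , (λ B ()) , (λ X p → p) , (λ X p p̄ → ⊥-elim (clash (H X) p p̄)) , bound
    where
    clash : ∀ b → T b → ¬ T (not b)
    clash true _ ()

  empty-bound : (H : Family n) → card H ≡ 0 → ℕtoℚ (card H) ℚ.* r₀ ^ℚ suc q ℚ.≤ r ^ℚ suc q ℚ.* ℕtoℚ (card A)
  empty-bound H = zero-bound (card H) (card A) (r₀ ^ℚ suc q) (r ^ℚ suc q)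
    {{^ℚ-nonNeg r (suc q) {{ℚ.pos⇒nonNeg r {{r>0}}}}}}

  -- `H` itself is the witness family for `X`. Members containing `X` are caught by `X`, all others
  -- by the approximation of the rest.
  extend : ∀ H X → H ⊆F F → ∣ X ∣ ≤ q → Spread r (link H X) → 0 < card (link H X) →
    Approximation (H without X) → Approximation H
  extend H X H⊆F ∣X∣≤q spread-X nonempty (S , F′ , witness , F′⊆ , caught , bound) =
    S⁺ , F′ , witness⁺ , (λ Y p → proj₁ (Equivalence.to T-∧ (F′⊆ Y p))) , caught⁺ , bound
    where
    S⁺ : Family n
    S⁺ B = ⌊ ≡-dec Bool._≟_ B X ⌋ ∨ S B
    witness⁺ : ∀ B → T (S⁺ B) → Witness B
    witness⁺ B p with Equivalence.to (T-∨ {x = ⌊ ≡-dec Bool._≟_ B X ⌋}) p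
    ... | inj₁ eq = subst Witness (sym (toWitness eq)) (∣X∣≤q , H , H⊆F , spread-X , nonempty)
    ... | inj₂ B∈S = witness B B∈S
    caught⁺ : ∀ Y → T (H Y) → T (not (F′ Y)) → Σ (Subset n) λ B → T (S⁺ B) × T (subsetᵇ B Y)
    caught⁺ Y Y∈H Y∉F′ = by-cases (T? (not (subsetᵇ X Y)))
      where
      by-cases : Dec (T (not (subsetᵇ X Y))) → Σ (Subset n) λ B → T (S⁺ B) × T (subsetᵇ B Y)
      by-cases (yes X⊈Y) =
        let B , B∈S , B⊆Y = caught Y (Equivalence.from T-∧ (Y∈H , X⊈Y)) Y∉F′
        in B , Equivalence.from (T-∨ {x = ⌊ ≡-dec Bool._≟_ B X ⌋}) (inj₂ B∈S) , B⊆Y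
      by-cases (no ¬X⊈Y) =
        X , Equivalence.from (T-∨ {x = ⌊ ≡-dec Bool._≟_ X X ⌋}) (inj₁ (fromWitness refl)) , T-stable (subsetᵇ X Y) ¬X⊈Y

  -- The fuel bounds the size of `H`. Each extraction removes the members containing `X`, of which
  -- there is at least one because the link is nonempty.
  approximate : ∀ fuel H → H ⊆F F → card H ≤ fuel → Approximation H
  approximate zero       H H⊆F H≤ = stop H (empty-bound H (n≤0⇒n≡0 H≤))
  approximate (suc fuel) H H⊆F H≤ = by-cases (card H ℕ.≟ 0) (∣ X ∣ ≤? q)
    where
    X = densest r {{r>0}} H
    by-cases : Dec (card H ≡ 0) → Dec (∣ X ∣ ≤ q) → Approximation H
    by-cases (yes H≡0) _         = stop H (empty-bound H H≡0)
    by-cases (no  _)   (no X≰q)  =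
      stop H (card-bound r {{r>0}} r₀ {{r₀>0}} A H q r≤r₀ spread (λ Y p → F⊆A Y (H⊆F Y p)) (≰⇒> X≰q))
    by-cases (no H≢0)  (yes X≤q) =
      extend H X H⊆F X≤q (densest-spread r {{r>0}} H) nonempty
        (approximate fuel (H without X) (λ Y p → H⊆F Y (proj₁ (Equivalence.to T-∧ p)))
          (ℕ.s≤s⁻¹ (≤-trans (≤-trans (+-monoˡ-≤ (card (H without X)) nonempty)
                                     (≤-reflexive (sym (card-without H X)))) H≤)))
      where nonempty = densest-nonempty r {{r>0}} H (n≢0⇒n>0 H≢0)

theorem11 : (n k t : ℕ) → 1 ℕ.≤ n → 1 ℕ.≤ k → 1 ℕ.≤ t →
    (A F : Family n) →
    ((X : Subset n) → T (F X) → T (A X) × ∣ X ∣ ℕ.≤ k) →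
    Intersecting t F →
    (q : ℕ) (r r₀ : ℚ) → 1 ℕ.≤ q → 1ℚ ℚ.≤ r → 1ℚ ℚ.≤ r₀ →
    LogBound k r → ℕtoℚ (2 ℕ.* q) ℚ.≤ r → r ℚ.< r₀ →
    Spread r₀ A →
    Σ (Family n) λ S → Σ (Family n) λ F′ →
    Intersecting t S ×
    ((B : Subset n) → T (S B) → ∣ B ∣ ℕ.≤ q) ×
    (F′ ⊆F F) ×
    ((X : Subset n) → T (F X) → T (not (F′ X)) →
    T (A X) × Σ (Subset n) λ B → T (S B) × T (subsetᵇ B X)) ×
    ((B : Subset n) → T (S B) →
    Σ (Family n) λ F_B → (F_B ⊆F F) × Spread r (link F_B B)) ×
    (ℕtoℚ (card F′) ℚ.* (r₀ ^ℚ suc q) ℚ.≤ (r ^ℚ suc q) ℚ.* ℕtoℚ (card A))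
theorem11 n k t _ 1≤k _ A F F-bounded F-intersecting q r r₀ 1≤q 1≤r 1≤r₀ logBound 2q≤r r<r₀ A-spread =
  let S , F′ , witness , F′⊆F , caught , bound =
        approximate A F q r r₀ (λ X X∈F → proj₁ (F-bounded X X∈F)) (ℚ.<⇒≤ r<r₀) A-spread (card F) F (λ X p → p) ≤-refl
  in S , F′ , S-intersecting S witness
     , (λ B B∈S → proj₁ (witness B B∈S))
     , F′⊆F
     , (λ X X∈F X∉F′ → proj₁ (F-bounded X X∈F) , caught X X∈F X∉F′)
     , (λ B B∈S → let _ , F_B , F_B⊆F , F_B-spread , _ = witness B B∈S in F_B , F_B⊆F , F_B-spread)
     , bound
  where
  instance
    r>0 : Positive r
    r>0 = ℚ.positive (ℚ.<-≤-trans (ℚ.positive⁻¹ 1ℚ) 1≤r)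
    r≥0 : NonNegative r
    r≥0 = ℚ.pos⇒nonNeg r
    r₀>0 : Positive r₀
    r₀>0 = ℚ.positive (ℚ.<-≤-trans (ℚ.positive⁻¹ 1ℚ) 1≤r₀)
    q≢0 : NonZero q
    q≢0 = ℕ.>-nonZero 1≤q

  S-intersecting : ∀ S →
    (∀ B → T (S B) → ∣ B ∣ ≤ q × Σ (Family n) λ F_B → (F_B ⊆F F) × Spread r (link F_B B) × 0 < card (link F_B B)) →
    Intersecting t S
  S-intersecting S witness B₁ B₂ B₁∈S B₂∈S =
    -- One `m` serves both ends: members of `F` have size below `2 ^ m`, and `4096 * m ≤ r`.
    let m , 1≤m , 2^m≤2k , k<2^m = ∃-log k 1≤k
        4096m≤r = LogBound⇒≤ k m r 2^m≤2k 1≤r logBound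
        B₁≤q , F₁ , F₁⊆F , spread₁ , nonempty₁ = witness B₁ B₁∈S
        B₂≤q , F₂ , F₂⊆F , spread₂ , nonempty₂ = witness B₂ B₂∈S
    in cross-intersection k m q {{ℕ.>-nonZero 1≤m}} k<2^m t F₁ F₂ B₁ B₂
         (λ X X∈F₁ → proj₂ (F-bounded X (F₁⊆F X X∈F₁))) (λ X X∈F₂ → proj₂ (F-bounded X (F₂⊆F X X∈F₂)))
         -- Both witness families lie in `F`, so they cross-intersect because `F` is
         -- `t`-intersecting.
         (λ X Y X∈F₁ Y∈F₂ → F-intersecting X Y (F₁⊆F X X∈F₁) (F₂⊆F Y Y∈F₂))
         B₁≤q B₂≤q nonempty₁ nonempty₂
         (Spread⇒Spreadℕ (2 * q) r (link F₁ B₁) 2q≤r spread₁)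
         (Spread⇒Spreadℕ (2 * (2048 * m)) r (link F₁ B₁) 4096m≤r spread₁)
         (Spread⇒Spreadℕ (2 * q) r (link F₂ B₂) 2q≤r spread₂)
         (Spread⇒Spreadℕ (2 * (2048 * m)) r (link F₂ B₂) 4096m≤r spread₂)
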